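{- Let $\Omega=[\alpha,\beta]\subset\mathbb{R}$ be a compact interval with $\alpha<\beta$, let $p_1,\dots,p_n\in(\alpha,\beta)$, and let $k_1,k_2,k_3,\dots\in\{1,\dots,n\}$ be a sequence in which every value $1,\dots,n$ occurs infinitely many times. Define the relaxation $$F_m=G_{p_{k_m}}G_{p_{k_{m-1}}}\cdots G_{p_{k_1}}0_\Omega,\qquad m\ge 1.$$ Then the sequence $(F_m)$ stabilizes: there exists $m_0$ such that $F_m=F_{m_0}$ for all $m\ge m_0$.
   Context: Let $\Omega=[\alpha,\beta]$ be a compact interval with $\alpha<\beta$ and $\Omega^\circ=(\alpha,\beta)$. An $\Omega$-tropical series is a function $F:\Omega\to[0,\infty)$ with $F(\alpha)=F(\beta)=0$ that can be written as $F(z)=\inf_{v\in\mathbb{Z}}(a_v+zv)$ for some real numbers $a_v$. Its canonical coefficients are the smallest possible such coefficients, namely $a_v=\sup_{z\in\Omega}(F(z)-zv)$. The function $0_\Omega$ is the $\Omega$-tropical series identically equal to $0$ on $\Omega$. For $p\in\Omega^\circ$ the operator $G_p$ on $\Omega$-tropical series is defined as follows: if $F$ is not differentiable at $p$, then $G_pF=F$; otherwise there is a unique $w\in\mathbb{Z}$ with $F(z)=a_w+zw$ for $z$ in a neighbourhood of $p$ (where $a_v$ are the canonical coefficients of $F$), and $G_pF(z)=\inf_{v\in\mathbb{Z}}(b_v+zv)$ for $z\in\Omega$, where $b_v=a_v$ for $v\neq w$ and $b_w=\min_{v\in\mathbb{Z}\setminus\{w\}}(a_v+pv)-pw$. -}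

module Defs where

open import Algebra.Bundles using (CommutativeRing)
open import Algebra.Structures using (IsCommutativeRing)
open import Algebra.Definitions.RawMonoid using () renaming (_×_ to multiple)
import Algebra.Construct.NaturalChoice.Max as Max
open import Axiom.ExcludedMiddle using (ExcludedMiddle)
open import Data.Fin using (Fin)
open import Data.Integer as ℤ using (ℤ; -[1+_])
open import Data.Nat using (ℕ; zero; suc)
open import Data.Product using (∃; _×_; _,_; proj₁; proj₂)
open import Data.Sum using (_⊎_)
open import Level using (0ℓ)
open import Relation.Binary.Bundles using (TotalOrder)
open import Relation.Binary.Core using (Rel)
open import Relation.Binary.PropositionalEquality using (_≢_)
open import Relation.Binary.Structures using (IsTotalOrder)
import Relation.Binary.Construct.NonStrictToStrict as ToStrict
open import Relation.Nullary using (¬_; yes; no)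

module Bounds {A : Set} (_≈_ _≤_ : Rel A 0ℓ) where

  IsUpperBound IsLowerBound : {I : Set} → (I → A) → A → Set
  IsUpperBound f u = ∀ i → f i ≤ u
  IsLowerBound f l = ∀ i → l ≤ f i

  IsSupremum IsInfimum IsMinimum : {I : Set} → (I → A) → A → Set
  IsSupremum f s = IsUpperBound f s × (∀ u → IsUpperBound f u → s ≤ u)
  IsInfimum  f s = IsLowerBound f s × (∀ l → IsLowerBound f l → l ≤ s)
  IsMinimum  f m = IsLowerBound f m × ∃ λ i → f i ≈ m

-- The real numbers enter axiomatically, as a Dedekind-complete ordered field
-- (unique up to isomorphism).  Bounded sets are presented as families.

record CompleteOrderedField : Set₁ where
  infix  4 _≈_ _≤_
  infixl 6 _+_ _-_
  infixl 7 _*_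
  infix  8 -_
  infix  9 _⁻¹
  field
    Carrier           : Set
    _≈_ _≤_           : Rel Carrier 0ℓ
    _+_ _*_           : Carrier → Carrier → Carrier
    -_ _⁻¹            : Carrier → Carrier
    0# 1#             : Carrier
    isCommutativeRing : IsCommutativeRing _≈_ _+_ _*_ -_ 0# 1#
    isTotalOrder      : IsTotalOrder _≈_ _≤_
    0≉1               : ¬ (0# ≈ 1#)
    -- 0# ⁻¹ is unconstrained.
    *-inverseʳ        : ∀ x → ¬ (x ≈ 0#) → x * x ⁻¹ ≈ 1#
    +-monoʳ-≤         : ∀ z {x y} → x ≤ y → z + x ≤ z + y
    *-nonNegative     : ∀ {x y} → 0# ≤ x → 0# ≤ y → 0# ≤ x * y

  open Bounds _≈_ _≤_ public

  field
    complete : {I : Set} (f : I → Carrier) → I → ∃ (IsUpperBound f) → ∃ (IsSupremum f)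

  commutativeRing : CommutativeRing 0ℓ 0ℓ
  commutativeRing = record { isCommutativeRing = isCommutativeRing }

  totalOrder : TotalOrder 0ℓ 0ℓ 0ℓ
  totalOrder = record { isTotalOrder = isTotalOrder }

  open Max totalOrder public using (_⊔_)
  open ToStrict _≈_ _≤_ public using () renaming (_<_ to infix 4 _<_)

  _-_ : Carrier → Carrier → Carrier
  x - y = x + - y

  ∣_∣ : Carrier → Carrier
  ∣ x ∣ = x ⊔ - x

  fromℤ : ℤ → Carrier
  fromℤ (ℤ.+ n)  = multiple (CommutativeRing.+-rawMonoid commutativeRing) n 1#
  fromℤ -[1+ n ] = - fromℤ (ℤ.+ suc n)

-- Excluded middle makes "F is differentiable at p" decidable, so that the
-- operator G can be defined by cases.

module Tropical (lem : ExcludedMiddle 0ℓ) (ℝ : CompleteOrderedField)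
                (α β : CompleteOrderedField.Carrier ℝ) where

  open CompleteOrderedField ℝ

  -- Total versions of sup, inf and min; the value is 0# if there is none.

  sup inf min : {I : Set} → (I → Carrier) → Carrier
  sup f with lem {∃ (IsSupremum f)}
  ... | yes (s , _) = s
  ... | no  _       = 0#
  inf f with lem {∃ (IsInfimum f)}
  ... | yes (s , _) = s
  ... | no  _       = 0#
  min f with lem {∃ (IsMinimum f)}
  ... | yes (m , _) = m
  ... | no  _       = 0#

  Ω Ω° : Set
  Ω  = ∃ λ z → α ≤ z × z ≤ β
  Ω° = ∃ λ z → α < z × z < β

  inΩ : Ω° → Ω
  inΩ (p , α<p , p<β) = p , proj₁ α<p , proj₁ p<β

  monomial : (ℤ → Carrier) → ℤ → Carrier → Carrier
  monomial a v z = a v + z * fromℤ v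

  IsTropicalSeries : (Ω → Carrier) → Set
  IsTropicalSeries F =
    (∀ z → 0# ≤ F z) ×
    (∀ z → proj₁ z ≈ α ⊎ proj₁ z ≈ β → F z ≈ 0#) ×
    (∃ λ a → ∀ z → IsInfimum (λ v → monomial a v (proj₁ z)) (F z))

  0Ω : Ω → Carrier
  0Ω _ = 0#

  coefficient : (Ω → Carrier) → ℤ → Carrier
  coefficient F v = sup λ (z : Ω) → F z - proj₁ z * fromℤ v

  -- | (F z - F p) / (z - p) - d | ≤ ε near p, multiplied out to cover z = p.
  HasDerivative : (Ω → Carrier) → Ω° → Carrier → Set
  HasDerivative F p d =
    ∀ ε → 0# < ε → ∃ λ δ → 0# < δ × (∀ (z : Ω) → ∣ proj₁ z - proj₁ p ∣ < δ →
      ∣ (F z - F (inΩ p)) - d * (proj₁ z - proj₁ p) ∣ ≤ ε * ∣ proj₁ z - proj₁ p ∣)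

  Differentiable : (Ω → Carrier) → Ω° → Set
  Differentiable F p = ∃ (HasDerivative F p)

  IsMonomialNear : (Ω → Carrier) → Ω° → ℤ → Set
  IsMonomialNear F p w =
    ∃ λ δ → 0# < δ × (∀ (z : Ω) → ∣ proj₁ z - proj₁ p ∣ < δ →
      F z ≈ monomial (coefficient F) w (proj₁ z))

  raise : (ℤ → Carrier) → ℤ → Carrier → ℤ → Carrier
  raise a w p v with v ℤ.≟ w
  ... | no  _ = a v
  ... | yes _ = min (λ ((u , _) : ∃ λ u → u ≢ w) → monomial a u p) - p * fromℤ w

  -- G is written for arbitrary functions on Ω.  On tropical series the second
  -- "no" case does not occur, and every sup, inf and min taken exists.
  G : Ω° → (Ω → Carrier) → (Ω → Carrier)
  G p F with lem {Differentiable F p}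
  ... | no  _ = F
  ... | yes _ with lem {∃ (IsMonomialNear F p)}
  ...   | no  _       = F
  ...   | yes (w , _) =
    λ z → inf λ v → monomial (raise (coefficient F) w (proj₁ p)) v (proj₁ z)

  -- k is indexed from 0: k m is the index of the point used in step m + 1.
  relaxation : ∀ {n} → (Fin n → Ω°) → (ℕ → Fin n) → ℕ → Ω → Carrier
  relaxation p k zero    = 0Ω
  relaxation p k (suc m) = G (p (k m)) (relaxation p k m)

{-# OPTIONS --safe #-}

-- Think of a series with coefficients a as particles on Ω: one at each corner
-- a v - a (v + 1), with infinitely many particles at α and at β.  If there is no
-- particle at p, then G p moves the two particles next to p towards p by the same
-- amount, until one of them lands on p; in terms of coefficients, a single a w grows.
--
-- All coefficients stay below those of a fixed series that is not smooth at any of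
-- the points p i and that agrees with the zero series at all but finitely many
-- exponents.  Hence only finitely many particles ever move, and all of them converge.
-- Late enough, a particle that lands on p i has p i as its limit.  Measure every
-- particle by its displacement from its limit.  A landing removes the displacement
-- of the landing particle and adds it to its neighbour: displacements to the left are
-- passed on to the right, displacements to the right are passed on to the left, and
-- merge with those they meet.  With finitely many particles this ends after finitely
-- many moves.

module Submission where

open import Defs
open import Axiom.ExcludedMiddle using (ExcludedMiddle)
open import Data.Fin using (Fin)
open import Data.Nat using (ℕ)
open import Data.Product using (∃; _×_)
open import Level using (0ℓ)
open import Relation.Binary.PropositionalEquality using (_≡_)

import Algebra.Construct.NaturalChoice.Max as Max
import Algebra.Construct.NaturalChoice.Min as Min
import Algebra.Properties.Group as GroupProperties
import Algebra.Properties.Ring as RingProperties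
import Algebra.Properties.Semiring.Mult as Mult
import Algebra.Solver.Ring as RingSolver
open import Algebra.Bundles using (AbelianGroup; CommutativeRing)
open import Algebra.Solver.Ring.AlmostCommutativeRing
  using (fromCommutativeRing; _-Raw-AlmostCommutative⟶_)
open import Data.Empty using (⊥-elim)
open import Data.Fin using (zero; suc)
open import Data.Integer as ℤ using (ℤ; -[1+_]; _⊖_)
import Data.Integer.Properties as ℤ
open import Data.Maybe using (Maybe; just; nothing)
open import Data.Nat as ℕ using (zero; suc; _∸_; z≤n; s≤s)
import Data.Nat.Properties as ℕ
open import Data.Product using (_,_; proj₁; proj₂)
import Data.Sign as Sign
open import Data.Sum using (_⊎_; inj₁; inj₂; [_,_]′)
open import Function using (_∘_)
open import Relation.Binary.Definitions using (tri<; tri≈; tri>)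
open import Relation.Binary.PropositionalEquality as ≡ using (_≢_)
open import Relation.Binary.Structures using (IsTotalOrder)
open import Relation.Nullary using (Dec; ¬_; yes; no)
open import Relation.Nullary.Decidable using (decidable-stable)
open GroupProperties (AbelianGroup.group ℤ.+-0-abelianGroup) using () renaming (∙-cancelˡ to +-cancelˡ)

-- Ordered-field arithmetic and a ring solver with integer constants.

module FieldProperties (ℝ : CompleteOrderedField) where

  open CompleteOrderedField ℝ
  open CommutativeRing commutativeRing using
    ( refl; sym; trans; reflexive; setoid; +-cong; +-congˡ; +-congʳ; *-congˡ
    ; -‿cong; +-identityʳ; semiring; ring; -‿inverseʳ ) public
  open Mult semiring using (×-homo-+; ×1-homo-*) renaming (_×_ to _·_)
  open RingProperties ring using (-‿distribˡ-*; -‿distribʳ-*; -‿involutive; -0#≈0#; -‿+-comm)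
  open import Relation.Binary.Reasoning.Setoid setoid

  fromℤ-neg : ∀ i → fromℤ (ℤ.- i) ≈ - fromℤ i
  fromℤ-neg (ℤ.+ zero)    = sym -0#≈0#
  fromℤ-neg (ℤ.+ (suc n)) = refl
  fromℤ-neg -[1+ n ]      = sym (-‿involutive _)

  x-y≈[z+x]-[z+y] : ∀ x y z → x - y ≈ (z + x) - (z + y)
  x-y≈[z+x]-[z+y] x y z = begin
    x - y                        ≈⟨ +-identityˡ _ ⟨
    0# + (x - y)                 ≈⟨ +-congʳ (-‿inverseʳ z) ⟨
    (z - z) + (x - y)            ≈⟨ +-assoc _ _ _ ⟩
    z + (- z + (x - y))          ≈⟨ +-congˡ (+-assoc _ _ _) ⟨
    z + (- z + x - y)            ≈⟨ +-congˡ (+-congʳ (+-comm _ _)) ⟩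
    z + (x - z - y)              ≈⟨ +-congˡ (+-assoc _ _ _) ⟩
    z + (x + (- z - y))          ≈⟨ +-assoc _ _ _ ⟨
    z + x + (- z - y)            ≈⟨ +-congˡ (-‿+-comm _ _) ⟩
    (z + x) - (z + y)            ∎
    where open CommutativeRing commutativeRing using (+-identityˡ; +-assoc; +-comm)

  fromℤ-⊖ : ∀ m n → fromℤ (m ⊖ n) ≈ m · 1# - n · 1#
  fromℤ-⊖ m zero = sym (trans (+-congˡ -0#≈0#) (+-identityʳ _))
  fromℤ-⊖ zero (suc n) = sym (CommutativeRing.+-identityˡ commutativeRing _)
  fromℤ-⊖ (suc m) (suc n) = begin
    fromℤ (suc m ⊖ suc n)       ≡⟨ ≡.cong fromℤ (ℤ.[1+m]⊖[1+n]≡m⊖n m n) ⟩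
    fromℤ (m ⊖ n)               ≈⟨ fromℤ-⊖ m n ⟩
    m · 1# - n · 1#             ≈⟨ x-y≈[z+x]-[z+y] _ _ 1# ⟩
    suc m · 1# - suc n · 1#     ∎

  fromℤ-+ : ∀ i j → fromℤ (i ℤ.+ j) ≈ fromℤ i + fromℤ j
  fromℤ-+ (ℤ.+ m) (ℤ.+ n) = ×-homo-+ 1# m n
  fromℤ-+ (ℤ.+ m) -[1+ n ] = fromℤ-⊖ m (suc n)
  fromℤ-+ -[1+ m ] (ℤ.+ n) = trans (fromℤ-⊖ n (suc m)) (CommutativeRing.+-comm commutativeRing _ _)
  fromℤ-+ -[1+ m ] -[1+ n ] = begin
    - (suc (suc (m ℕ.+ n)) · 1#)     ≡⟨ ≡.cong (λ k → - (suc k · 1#)) (ℕ.+-suc m n) ⟨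
    - ((suc m ℕ.+ suc n) · 1#)       ≈⟨ -‿cong (×-homo-+ 1# (suc m) (suc n)) ⟩
    - (suc m · 1# + suc n · 1#)      ≈⟨ -‿+-comm _ _ ⟨
    - (suc m · 1#) - (suc n · 1#)    ∎

  fromℤ-minus : ∀ k → fromℤ (Sign.- ℤ.◃ k) ≈ - (k · 1#)
  fromℤ-minus zero    = sym -0#≈0#
  fromℤ-minus (suc k) = refl

  fromℤ-* : ∀ i j → fromℤ (i ℤ.* j) ≈ fromℤ i * fromℤ j
  fromℤ-* (ℤ.+ m) (ℤ.+ n) = begin
    fromℤ (Sign.+ ℤ.◃ m ℕ.* n)   ≡⟨ ≡.cong fromℤ (ℤ.+◃n≡+n (m ℕ.* n)) ⟩
    (m ℕ.* n) · 1#               ≈⟨ ×1-homo-* m n ⟩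
    m · 1# * (n · 1#)            ∎
  fromℤ-* (ℤ.+ m) -[1+ n ] = begin
    fromℤ (Sign.- ℤ.◃ m ℕ.* suc n)   ≈⟨ fromℤ-minus (m ℕ.* suc n) ⟩
    - ((m ℕ.* suc n) · 1#)           ≈⟨ -‿cong (×1-homo-* m (suc n)) ⟩
    - (m · 1# * (suc n · 1#))        ≈⟨ -‿distribʳ-* _ _ ⟩
    m · 1# * - (suc n · 1#)          ∎
  fromℤ-* -[1+ m ] (ℤ.+ n) = begin
    fromℤ (Sign.- ℤ.◃ suc m ℕ.* n)   ≈⟨ fromℤ-minus (suc m ℕ.* n) ⟩
    - ((suc m ℕ.* n) · 1#)           ≈⟨ -‿cong (×1-homo-* (suc m) n) ⟩
    - (suc m · 1# * (n · 1#))        ≈⟨ -‿distribˡ-* _ _ ⟩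
    - (suc m · 1#) * (n · 1#)        ∎
  fromℤ-* -[1+ m ] -[1+ n ] = begin
    (suc m ℕ.* suc n) · 1#           ≈⟨ ×1-homo-* (suc m) (suc n) ⟩
    suc m · 1# * (suc n · 1#)        ≈⟨ -‿involutive _ ⟨
    - - (suc m · 1# * (suc n · 1#))  ≈⟨ -‿cong (-‿distribʳ-* _ _) ⟩
    - (suc m · 1# * - (suc n · 1#))  ≈⟨ -‿distribˡ-* _ _ ⟩
    - (suc m · 1#) * - (suc n · 1#)  ∎

  -- Makes integers the coefficients of the solver. In it, `con (ℤ.+ 1)` stands for `1# + 0#`, which
  -- is why `+-identityʳ 1#` reappears wherever a numeral meets `1#`.
  fromℤ-homomorphism : ℤ.+-*-rawRing -Raw-AlmostCommutative⟶ fromCommutativeRing commutativeRing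
  fromℤ-homomorphism = record
    { ⟦_⟧    = fromℤ
    ; +-homo = fromℤ-+
    ; *-homo = fromℤ-*
    ; -‿homo = fromℤ-neg
    ; 0-homo = refl
    ; 1-homo = +-identityʳ 1#
    }

  fromℤ≟ : ∀ i j → Maybe (fromℤ i ≈ fromℤ j)
  fromℤ≟ i j with i ℤ.≟ j
  ... | yes i≡j = just (reflexive (≡.cong fromℤ i≡j))
  ... | no  _   = nothing

  open RingSolver ℤ.+-*-rawRing (fromCommutativeRing commutativeRing) fromℤ-homomorphism fromℤ≟ public
    using (solve; _:=_; _:+_; _:*_; _:-_; :-_; con)

  open IsTotalOrder isTotalOrder public using ()
    renaming ( total to ≤-total; antisym to ≤-antisym; trans to ≤-trans; reflexive to ≤-reflexive
             ; ≲-respˡ-≈ to ≤-respˡ-≈; ≲-respʳ-≈ to ≤-respʳ-≈)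

  ≤-refl : ∀ {x} → x ≤ x
  ≤-refl = ≤-reflexive refl

  ≤-resp-≈ : ∀ {x x′ y y′} → x ≈ x′ → y ≈ y′ → x ≤ y → x′ ≤ y′
  ≤-resp-≈ x≈x′ y≈y′ x≤y = ≤-respˡ-≈ x≈x′ (≤-respʳ-≈ y≈y′ x≤y)

  <⇒≤ : ∀ {x y} → x < y → x ≤ y
  <⇒≤ = proj₁

  <⇒≱ : ∀ {x y} → x < y → ¬ (y ≤ x)
  <⇒≱ (x≤y , x≉y) y≤x = x≉y (≤-antisym x≤y y≤x)

  ≰⇒> : ∀ {x y} → ¬ (y ≤ x) → x < y
  ≰⇒> {x} {y} y≰x = [ (λ x≤y → x≤y) , (λ y≤x → ⊥-elim (y≰x y≤x)) ]′ (≤-total x y)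
                  , λ x≈y → y≰x (≤-reflexive (sym x≈y))

  <-≤-trans : ∀ {x y z} → x < y → y ≤ z → x < z
  <-≤-trans x<y y≤z = ≰⇒> λ z≤x → <⇒≱ x<y (≤-trans y≤z z≤x)

  ≤-<-trans : ∀ {x y z} → x ≤ y → y < z → x < z
  ≤-<-trans x≤y y<z = ≰⇒> λ z≤x → <⇒≱ y<z (≤-trans z≤x x≤y)

  0≤y-x : ∀ {x y} → x ≤ y → 0# ≤ y - x
  0≤y-x {x} {y} x≤y = ≤-resp-≈ (solve 1 (λ x → :- x :+ x := con (ℤ.+ 0)) refl x)
                               (solve 2 (λ x y → :- x :+ y := y :- x) refl x y)
                               (+-monoʳ-≤ (- x) x≤y)

  -- Linear inequalities are proved by writing the difference of the two sides
  -- as a sum of non-negative terms, which is a ring identity.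
  ≤-by : ∀ {x y d} → y - x ≈ d → 0# ≤ d → x ≤ y
  ≤-by {x} {y} y-x≈d 0≤d =
    ≤-resp-≈ (+-identityʳ x)
             (trans (+-congˡ (sym y-x≈d)) (solve 2 (λ x y → x :+ (y :- x) := y) refl x y))
             (+-monoʳ-≤ x 0≤d)

  0≤-+ : ∀ {x y} → 0# ≤ x → 0# ≤ y → 0# ≤ x + y
  0≤-+ {x} 0≤x 0≤y = ≤-trans 0≤x (≤-respˡ-≈ (+-identityʳ x) (+-monoʳ-≤ x 0≤y))

  -- Strict counterpart of `≤-by`: strictness is inherited from one known strict inequality, and the
  -- rest of the difference only has to be non-negative.
  <-by : ∀ {x y x′ y′ d} → y - x ≈ (y′ - x′) + d → x′ < y′ → 0# ≤ d → x < y
  <-by {x} {y} {x′} {y′} {d} eq x′<y′ 0≤d = ≰⇒> λ y≤x → <⇒≱ x′<y′ (≤-by {d = (x - y) + d}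
    (trans (solve 3 (λ a b d → b :- a := (:- (a :- b :+ d)) :+ d) refl y′ x′ d)
           (+-congʳ (trans (-‿cong (sym eq)) (solve 2 (λ x y → :- (y :- x) := x :- y) refl x y))))
    (0≤-+ (0≤y-x y≤x) 0≤d))

  0<y-x : ∀ {x y} → x < y → 0# < y - x
  0<y-x x<y = <-by (solve 2 (λ x y → (y :- x) :- con (ℤ.+ 0) := (y :- x) :+ con (ℤ.+ 0)) refl _ _) x<y ≤-refl

-- Finite sums, eventual properties, and descent of a natural-valued potential.

sumUpTo : ℕ → (ℕ → ℕ) → ℕ
sumUpTo zero    f = 0
sumUpTo (suc k) f = f k ℕ.+ sumUpTo k f

sumUpTo-cong : ∀ {f g} k → (∀ l → l ℕ.< k → f l ≡ g l) → sumUpTo k f ≡ sumUpTo k g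
sumUpTo-cong zero    f≗g = ≡.refl
sumUpTo-cong (suc k) f≗g =
  ≡.cong₂ ℕ._+_ (f≗g k ℕ.≤-refl) (sumUpTo-cong k λ l l<k → f≗g l (ℕ.m<n⇒m<1+n l<k))

-- Only the total over two adjacent indices has to drop; one of the two terms may grow. This is the
-- shape of a landing, which hands weight from a particle to its neighbour.
sumUpTo-< : ∀ {f g j} k → suc (suc j) ℕ.≤ k →
            (∀ l → l ≢ j → l ≢ suc j → f l ≡ g l) →
            f j ℕ.+ f (suc j) ℕ.< g j ℕ.+ g (suc j) → sumUpTo k f ℕ.< sumUpTo k g
sumUpTo-< {f} {g} {j} (suc k) (s≤s j<k) f≗g fj<gj with ℕ.m≤n⇒m<n∨m≡n j<k
... | inj₂ ≡.refl = begin-strict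
  f (suc j) ℕ.+ (f j ℕ.+ sumUpTo j f) ≡⟨ swap f ⟩
  f j ℕ.+ f (suc j) ℕ.+ sumUpTo j f   <⟨ ℕ.+-monoˡ-< (sumUpTo j f) fj<gj ⟩
  g j ℕ.+ g (suc j) ℕ.+ sumUpTo j f   ≡⟨ ≡.cong (g j ℕ.+ g (suc j) ℕ.+_) tail ⟩
  g j ℕ.+ g (suc j) ℕ.+ sumUpTo j g   ≡⟨ swap g ⟨
  g (suc j) ℕ.+ (g j ℕ.+ sumUpTo j g) ∎
  where
  open ℕ.≤-Reasoning
  swap : ∀ h → h (suc j) ℕ.+ (h j ℕ.+ sumUpTo j h) ≡ h j ℕ.+ h (suc j) ℕ.+ sumUpTo j h
  swap h = ≡.trans (≡.sym (ℕ.+-assoc (h (suc j)) (h j) _))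
                   (≡.cong (ℕ._+ sumUpTo j h) (ℕ.+-comm (h (suc j)) (h j)))
  tail : sumUpTo j f ≡ sumUpTo j g
  tail = sumUpTo-cong j λ l l<j → f≗g l (ℕ.<⇒≢ l<j) (ℕ.<⇒≢ (ℕ.m<n⇒m<1+n l<j))
... | inj₁ 1+j<k = ≡.subst (λ x → x ℕ.+ sumUpTo k f ℕ.< g k ℕ.+ sumUpTo k g)
  (≡.sym (f≗g k (ℕ.<⇒≢ j<k ∘ ≡.sym) (ℕ.<⇒≢ 1+j<k ∘ ≡.sym)))
  (ℕ.+-monoʳ-< (g k) (sumUpTo-< {f} {g} k 1+j<k f≗g fj<gj))

Eventually : (ℕ → Set) → Set
Eventually P = ∃ λ M → ∀ m → M ℕ.≤ m → P m

eventually-<-∀ : {P : ℕ → ℕ → Set} → ∀ k → (∀ j → Eventually (P j)) →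
                 Eventually λ m → ∀ j → j ℕ.< k → P j m
eventually-<-∀ zero    ev = 0 , λ _ _ _ ()
eventually-<-∀ {P} (suc k) ev with eventually-<-∀ k ev | ev k
... | M , below | M′ , at = M ℕ.⊔ M′ , λ m M≤m j j<1+k →
  [ below m (ℕ.m⊔n≤o⇒m≤o M M′ M≤m) j
  , (λ { ≡.refl → at m (ℕ.m⊔n≤o⇒n≤o M M′ M≤m) }) ]′ (ℕ.m≤n⇒m<n∨m≡n (ℕ.≤-pred j<1+k))

eventually-Fin-∀ : ∀ {n} {P : Fin n → ℕ → Set} → (∀ i → Eventually (P i)) →
                   Eventually λ m → ∀ i → P i m
eventually-Fin-∀ {zero}  ev = 0 , λ _ _ ()
eventually-Fin-∀ {suc n} ev with eventually-Fin-∀ (ev ∘ suc) | ev zero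
... | M , rest | M′ , first = M ℕ.⊔ M′ , λ where
  m M≤m zero    → first m (ℕ.m⊔n≤o⇒n≤o M M′ M≤m)
  m M≤m (suc i) → rest m (ℕ.m⊔n≤o⇒m≤o M M′ M≤m) i

-- From `M` on, `Φ` never grows and every occurrence of `P` lowers it, so `P` occurs at most `Φ M`
-- more times.
eventually-never : ExcludedMiddle 0ℓ → {P : ℕ → Set} (Φ : ℕ → ℕ) →
                   (∀ m → Φ (suc m) ℕ.≤ Φ m ⊎ P m) →
                   (Eventually λ m → P m → Φ (suc m) ℕ.< Φ m) →
                   Eventually λ m → ¬ P m
eventually-never lem {P} Φ stays (M , drops) = search (Φ M) M ℕ.≤-refl ℕ.≤-refl
  where
  antitone : ∀ {l m} → M ℕ.≤ l → l ℕ.≤′ m → Φ m ℕ.≤ Φ l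
  antitone M≤l ℕ.≤′-refl = ℕ.≤-refl
  antitone M≤l (ℕ.≤′-step {n = m} l≤m) = ℕ.≤-trans
    ([ (λ le → le) , (λ Pm → ℕ.<⇒≤ (drops m (ℕ.≤-trans M≤l (ℕ.≤′⇒≤ l≤m)) Pm)) ]′ (stays m))
    (antitone M≤l l≤m)

  -- `b` bounds how many occurrences of `P` can follow `l`; the recursion is on `b`, and each
  -- occurrence found uses up one unit.
  search : ∀ b l → M ℕ.≤ l → Φ l ℕ.≤ b → Eventually λ m → ¬ P m
  search b l M≤l Φl≤b with lem {∃ λ m → l ℕ.≤ m × P m}
  ... | no  none            = l , λ m l≤m Pm → none (m , l≤m , Pm)
  ... | yes (m , l≤m , Pm) = continue b Φl≤b
    where
    M≤m = ℕ.≤-trans M≤l l≤m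
    Φ-drops : Φ (suc m) ℕ.< Φ l
    Φ-drops = ℕ.<-≤-trans (drops m M≤m Pm) (antitone M≤l (ℕ.≤⇒≤′ l≤m))
    continue : ∀ b → Φ l ℕ.≤ b → Eventually λ m → ¬ P m
    continue zero    Φl≤0  = ⊥-elim (ℕ.n≮0 (ℕ.<-≤-trans Φ-drops Φl≤0))
    continue (suc b) Φl≤1+b =
      search b (suc m) (ℕ.m≤n⇒m≤1+n M≤m) (ℕ.≤-pred (ℕ.<-≤-trans Φ-drops Φl≤1+b))

-- The particle system and its termination.

module Particles (lem : ExcludedMiddle 0ℓ) (ℝ : CompleteOrderedField) {n : ℕ}
                 (p : Fin n → CompleteOrderedField.Carrier ℝ) (K : ℕ)
                 (A : ℕ → ℕ → CompleteOrderedField.Carrier ℝ) where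

  open CompleteOrderedField ℝ
  open FieldProperties ℝ

  ≮⇒≥ : ∀ {x y} → ¬ (x < y) → y ≤ x
  ≮⇒≥ x≮y = decidable-stable lem λ y≰x → x≮y (≰⇒> y≰x)

  position : ℕ → ℕ → Carrier
  position m j = A m (suc j) - A m j

  -- Raising `A m (suc j)` alone shifts particle `j` to the right and particle `suc j` to the left
  -- by the same amount. `2+j≤K` keeps both among the `K` particles counted by the potential.
  -- `raised` may be weak because `lands` already says that the landing particle has really moved.
  record Move (m : ℕ) : Set where
    field
      {j}    : ℕ
      {i}    : Fin n
      2+j≤K  : suc (suc j) ℕ.≤ K
      raised : A m (suc j) ≤ A (suc m) (suc j)
      others : ∀ l → l ≢ suc j → A (suc m) l ≈ A m l
      lands  : (position m j < p i × position (suc m) j ≈ p i) ⊎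
               (p i < position m (suc j) × position (suc m) (suc j) ≈ p i)

  module Termination (bound : ∀ j → ∃ λ h → ∀ m → A m j ≤ h)
                     (step : ∀ m → (∀ j → A (suc m) j ≈ A m j) ⊎ Move m) where

    A-mono-suc : ∀ m j → A m j ≤ A (suc m) j
    A-mono-suc m j with step m
    ... | inj₁ stays = ≤-reflexive (sym (stays j))
    ... | inj₂ move with j ℕ.≟ suc (Move.j move)
    ...   | yes ≡.refl = Move.raised move
    ...   | no  j≢     = ≤-reflexive (sym (Move.others move j j≢))

    A-mono : ∀ {l m} j → l ℕ.≤′ m → A l j ≤ A m j
    A-mono j ℕ.≤′-refl               = ≤-refl
    A-mono j (ℕ.≤′-step {n = m} l≤m) = ≤-trans (A-mono j l≤m) (A-mono-suc m j)

    limits : ∀ j → ∃ (IsSupremum λ m → A m j)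
    limits j = complete (λ m → A m j) 0 (bound j)

    A∞ : ℕ → Carrier
    A∞ j = proj₁ (limits j)

    A≤A∞ : ∀ m j → A m j ≤ A∞ j
    A≤A∞ m j = proj₁ (proj₂ (limits j)) m

    position∞ : ℕ → Carrier
    position∞ j = A∞ (suc j) - A∞ j

    -- If `A m j` stayed at distance `η` or more, `A∞ j - η` would be a smaller upper bound. Once
    -- close, it remains close by monotonicity.
    eventually-close : ∀ j η → 0# < η → Eventually λ m → A∞ j - A m j < η
    eventually-close j η 0<η with lem {∃ λ m → A∞ j - A m j < η}
    ... | yes (m , close) = m , λ m′ m≤m′ → ≤-<-trans
      (≤-by (solve 3 (λ s a b → (s :- a) :- (s :- b) := b :- a) refl _ _ _)
            (0≤y-x (A-mono j (ℕ.≤⇒≤′ m≤m′))))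
      close
    ... | no  far = ⊥-elim (<⇒≱ 0<η (≤-by
      (solve 2 (λ s η → con (ℤ.+ 0) :- η := (s :- η) :- s) refl _ _)
      (0≤y-x (proj₂ (proj₂ (limits j)) (A∞ j - η) λ m → ≤-by
        (solve 3 (λ s a η → (s :- η) :- a := (s :- a) :- η) refl _ _ _)
        (0≤y-x (≮⇒≥ λ close → far (m , close)))))))

    -- |position∞ j - position m j| is at most the larger of the remaining rises
    -- of A m (suc j) and A m j, so a particle that lands on p i arbitrarily late
    -- converges to p i.
    lands⇒limit : ∀ i j → Eventually λ m → position m j ≈ p i → position∞ j ≈ p i
    lands⇒limit i j with lem {position∞ j ≈ p i}
    ... | yes eq = 0 , λ _ _ _ → eq
    ... | no neq with ≤-total (position∞ j) (p i)
    ...   | inj₁ L≤p with eventually-close j (p i - position∞ j)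
                            (0<y-x (L≤p , neq))
    ...     | M , close = M , λ m M≤m at → ⊥-elim (<⇒≱ (close m M≤m) (≤-by
              (trans (+-congˡ (-‿cong (+-congʳ (sym at))))
                (solve 4 (λ s t a b → (s :- a) :- ((b :- a) :- (t :- s)) := t :- b) refl _ _ _ _))
              (0≤y-x (A≤A∞ m (suc j)))))
    lands⇒limit i j | no neq | inj₂ p≤L with eventually-close (suc j) (position∞ j - p i)
                            (0<y-x (p≤L , neq ∘ sym))
    ...     | M , close = M , λ m M≤m at → ⊥-elim (<⇒≱ (close m M≤m) (≤-by
              (trans (+-congˡ (-‿cong (+-congˡ (-‿cong (sym at)))))
                (solve 4 (λ s t a b → (t :- b) :- ((t :- s) :- (b :- a)) := s :- a) refl _ _ _ _))
              (0≤y-x (A≤A∞ m j))))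

    -- The number of particles that the displacement of particle j can still reach:
    -- those to the right if it lies below its limit, those to the left if above.
    weight : ℕ → Carrier → ℕ
    weight j x with lem {x < position∞ j} | lem {position∞ j < x}
    ... | yes _ | _     = K ∸ j
    ... | no  _ | yes _ = suc j
    ... | no  _ | no  _ = 0

    weight-below : ∀ {j x} → x < position∞ j → weight j x ≡ K ∸ j
    weight-below {j} {x} x<L with lem {x < position∞ j} | lem {position∞ j < x}
    ... | yes _   | _ = ≡.refl
    ... | no  x≮L | _ = ⊥-elim (x≮L x<L)

    weight-above : ∀ {j x} → position∞ j < x → weight j x ≡ suc j
    weight-above {j} {x} L<x with lem {x < position∞ j} | lem {position∞ j < x}
    ... | yes x<L | _       = ⊥-elim (<⇒≱ L<x (<⇒≤ x<L))
    ... | no  _   | yes _   = ≡.refl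
    ... | no  _   | no  L≮x = ⊥-elim (L≮x L<x)

    weight-at : ∀ {j x} → x ≈ position∞ j → weight j x ≡ 0
    weight-at {j} {x} x≈L with lem {x < position∞ j} | lem {position∞ j < x}
    ... | yes x<L | _       = ⊥-elim (proj₂ x<L x≈L)
    ... | no  _   | yes L<x = ⊥-elim (proj₂ L<x (sym x≈L))
    ... | no  _   | no  _   = ≡.refl

    -- A particle pushed left may end below its limit, which costs `K ∸ j`. If it is still above, it
    -- was above before and its weight is unchanged; at the limit the weight is `0`.
    weight-lowered : ∀ j {x y} → y ≤ x → weight j y ℕ.≤ weight j x ⊎ weight j y ℕ.≤ K ∸ j
    weight-lowered j {x} {y} y≤x with lem {y < position∞ j} | lem {position∞ j < y}
    ... | yes _ | _       = inj₂ ℕ.≤-refl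
    ... | no  _ | yes L<y = inj₁ (ℕ.≤-reflexive (≡.sym (weight-above (<-≤-trans L<y y≤x))))
    ... | no  _ | no  _   = inj₁ z≤n

    weight-lifted : ∀ j {x y} → x ≤ y → weight j y ℕ.≤ weight j x ⊎ weight j y ℕ.≤ suc j
    weight-lifted j {x} {y} x≤y with lem {y < position∞ j} | lem {position∞ j < y}
    ... | yes y<L | _     = inj₁ (ℕ.≤-reflexive (≡.sym (weight-below (≤-<-trans x≤y y<L))))
    ... | no  _   | yes _ = inj₂ ℕ.≤-refl
    ... | no  _   | no  _ = inj₂ z≤n

    weight-cong : ∀ j {x y} → x ≈ y → weight j y ≡ weight j x
    weight-cong j {x} {y} x≈y with lem {y < position∞ j} | lem {position∞ j < y}
    ... | yes y<L | _       = ≡.sym (weight-below (≤-<-trans (≤-reflexive x≈y) y<L))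
    ... | no  _   | yes L<y = ≡.sym (weight-above (<-≤-trans L<y (≤-reflexive (sym x≈y))))
    ... | no  y≮L | no  L≮y = ≡.sym (weight-at (trans x≈y (≤-antisym (≮⇒≥ L≮y) (≮⇒≥ y≮L))))

    potential : ℕ → ℕ
    potential m = sumUpTo K λ j → weight j (position m j)

    -- A late landing ends at the limit, so the landing particle loses its whole weight: `K ∸ j` for
    -- particle `j`, `suc (suc j)` for particle `suc j`. Its neighbour either gains nothing or ends
    -- with a weight at most one less than the amount lost, since the displacement it receives has
    -- one particle fewer to reach.
    potential-drops : Eventually λ m → Move m → potential (suc m) ℕ.< potential m
    potential-drops with eventually-<-∀ K (λ j → eventually-Fin-∀ (λ i → lands⇒limit i j))
    ... | M , limit = M , λ m M≤m move → let open Move move in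
      sumUpTo-< K 2+j≤K
        (λ l l≢j l≢1+j → weight-cong l
          (sym (+-cong (others (suc l) (l≢j ∘ ℕ.suc-injective)) (-‿cong (others l l≢1+j)))))
        (drops m M≤m move lands)
      where
      drops : ∀ m → M ℕ.≤ m → (move : Move m) → let open Move move in
              (position m j < p i × position (suc m) j ≈ p i) ⊎
              (p i < position m (suc j) × position (suc m) (suc j) ≈ p i) →
              weight j (position (suc m) j) ℕ.+ weight (suc j) (position (suc m) (suc j)) ℕ.<
              weight j (position m j) ℕ.+ weight (suc j) (position m (suc j))
      drops m M≤m move (inj₁ (x<p , lands)) = begin-strict
        weight j (position (suc m) j) ℕ.+ weight (suc j) (position (suc m) (suc j))
          ≡⟨ ≡.cong (ℕ._+ weight (suc j) (position (suc m) (suc j))) (weight-at (trans lands (sym L≈p))) ⟩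
        weight (suc j) (position (suc m) (suc j))
          <⟨ [ (λ le → ℕ.+-mono-<-≤ (ℕ.m<n⇒0<n∸m j<K) le)
             , (λ le → ℕ.<-≤-trans (s≤s le) (ℕ.≤-trans (ℕ.≤-reflexive
                  (≡.sym (ℕ.+-∸-assoc 1 j<K))) (ℕ.m≤m+n _ _)))
             ]′ (weight-lowered (suc j)
                  (≤-resp-≈ (+-congʳ (sym (others _ (ℕ.1+n≢n ∘ ℕ.suc-injective)))) refl
                  (≤-by (solve 3 (λ a b c → (c :- a) :- (c :- b) := b :- a) refl _ _ _)
                        (0≤y-x raised)))) ⟩
        K ∸ j ℕ.+ weight (suc j) (position m (suc j))
          ≡⟨ ≡.cong (ℕ._+ weight (suc j) (position m (suc j)))
               (weight-below (<-≤-trans x<p (≤-reflexive (sym L≈p)))) ⟨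
        weight j (position m j) ℕ.+ weight (suc j) (position m (suc j)) ∎
        where
        open Move move hiding (lands)
        open ℕ.≤-Reasoning
        j<K = ℕ.<⇒≤ 2+j≤K
        -- The time is `suc m` because the position equal to `p i` is the one after the move.
        L≈p = limit (suc m) (ℕ.m≤n⇒m≤1+n M≤m) j j<K i lands
      drops m M≤m move (inj₂ (p<x , lands)) = begin-strict
        weight j (position (suc m) j) ℕ.+ weight (suc j) (position (suc m) (suc j))
          ≡⟨ ≡.cong (weight j (position (suc m) j) ℕ.+_) (weight-at (trans lands (sym L≈p))) ⟩
        weight j (position (suc m) j) ℕ.+ 0
          ≡⟨ ℕ.+-identityʳ _ ⟩
        weight j (position (suc m) j)
          <⟨ [ (λ le → ℕ.≤-<-trans le (ℕ.m<m+n _ (s≤s z≤n)))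
             , (λ le → ℕ.<-≤-trans (s≤s le) (ℕ.m≤n+m _ _))
             ]′ (weight-lifted j
                  (≤-resp-≈ refl (+-congˡ (-‿cong (sym (others _ (ℕ.1+n≢n ∘ ≡.sym)))))
                  (≤-by (solve 3 (λ a b c → (c :- a) :- (b :- a) := c :- b) refl _ _ _)
                        (0≤y-x raised)))) ⟩
        weight j (position m j) ℕ.+ suc (suc j)
          ≡⟨ ≡.cong (weight j (position m j) ℕ.+_)
               (weight-above (≤-<-trans (≤-reflexive L≈p) p<x)) ⟨
        weight j (position m j) ℕ.+ weight (suc j) (position m (suc j)) ∎
        where
        open Move move hiding (lands)
        open ℕ.≤-Reasoning
        L≈p = limit (suc m) (ℕ.m≤n⇒m≤1+n M≤m) (suc j) 2+j≤K i lands

    moves-terminate : Eventually λ m → ¬ Move m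
    moves-terminate = eventually-never lem potential stays potential-drops
      where
      stays : ∀ m → potential (suc m) ℕ.≤ potential m ⊎ Move m
      stays m with step m
      ... | inj₂ move = inj₂ move
      ... | inj₁ same = inj₁ (ℕ.≤-reflexive (sumUpTo-cong K λ j _ →
        weight-cong j (sym (+-cong (same (suc j)) (-‿cong (same j))))))

-- Integer offsets, and halves in an ordered field.

≤⇒offset : ∀ {i j} → i ℤ.≤ j → ∃ λ k → j ≡ ℤ.+ k ℤ.+ i
≤⇒offset {i} {j} i≤j = ℤ.∣ j ℤ.- i ∣ , (begin
  j                            ≡⟨ ℤ.+-identityʳ j ⟨
  j ℤ.+ ℤ.0ℤ                   ≡⟨ ≡.cong (λ k → j ℤ.+ k) (ℤ.+-inverseˡ i) ⟨
  j ℤ.+ (ℤ.- i ℤ.+ i)          ≡⟨ ℤ.+-assoc j (ℤ.- i) i ⟨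
  j ℤ.- i ℤ.+ i                ≡⟨ ≡.cong (ℤ._+ i) (ℤ.0≤i⇒+∣i∣≡i (ℤ.i≤j⇒0≤j-i i≤j)) ⟨
  ℤ.+ ℤ.∣ j ℤ.- i ∣ ℤ.+ i      ∎)
  where open ≡.≡-Reasoning

module Halving (ℝ : CompleteOrderedField) where

  open CompleteOrderedField ℝ
  open FieldProperties ℝ

  -- If 2 were 0, then 1 would equal -1, so whichever sign 1 has it also has the opposite one, and
  -- antisymmetry gives `0≉1` a contradiction.
  2≉0 : ¬ (fromℤ (ℤ.+ 2) ≈ 0#)
  2≉0 2≈0 with ≤-total 0# (fromℤ (ℤ.+ 1))
  ... | inj₁ 0≤1 = 0≉1 (trans (≤-antisym 0≤1 (≤-by
    (trans (solve 0 (con (ℤ.+ 0) :- con (ℤ.+ 1) := con (ℤ.+ 1) :- con (ℤ.+ 2)) refl)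
           (trans (+-congˡ (-‿cong 2≈0)) (solve 0 (con (ℤ.+ 1) :- con (ℤ.+ 0) := con (ℤ.+ 1)) refl)))
    0≤1)) (+-identityʳ 1#))
  ... | inj₂ 1≤0 = 0≉1 (trans (≤-antisym (≤-by
    (trans (solve 0 (con (ℤ.+ 1) :- con (ℤ.+ 0) := con (ℤ.+ 2) :+ (con (ℤ.+ 0) :- con (ℤ.+ 1))) refl)
           (trans (+-congʳ 2≈0) (solve 0 (con (ℤ.+ 0) :+ (con (ℤ.+ 0) :- con (ℤ.+ 1)) := con (ℤ.+ 0) :- con (ℤ.+ 1)) refl)))
    (0≤y-x 1≤0)) 1≤0) (+-identityʳ 1#))

  half : Carrier → Carrier
  half x = x * fromℤ (ℤ.+ 2) ⁻¹

  half+half : ∀ x → half x + half x ≈ x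
  half+half x = trans
    (solve 2 (λ x r → x :* r :+ x :* r := x :* (con (ℤ.+ 2) :* r)) refl x (fromℤ (ℤ.+ 2) ⁻¹))
    (trans (*-congˡ (trans (*-inverseʳ _ 2≉0) (sym (+-identityʳ 1#))))
           (solve 1 (λ x → x :* con (ℤ.+ 1) := x) refl x))

  0<half : ∀ {x} → 0# < x → 0# < half x
  0<half {x} 0<x = ≰⇒> λ h≤0 → <⇒≱ 0<x (≤-by
    (trans (+-congˡ (-‿cong (sym (half+half x))))
      (solve 1 (λ h → con (ℤ.+ 0) :- (h :+ h) := (con (ℤ.+ 0) :- h) :+ (con (ℤ.+ 0) :- h)) refl (half x)))
    (0≤-+ (0≤y-x h≤0) (0≤y-x h≤0)))

  half< : ∀ {x} → 0# < x → half x < x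
  half< {x} 0<x = <-by
    (trans (+-congʳ (sym (half+half x)))
      (solve 1 (λ h → (h :+ h) :- h := (h :- con (ℤ.+ 0)) :+ con (ℤ.+ 0)) refl (half x)))
    (0<half 0<x) ≤-refl

-- Infima of monomials and the corners of a coefficient sequence.

module Series (lem : ExcludedMiddle 0ℓ) (ℝ : CompleteOrderedField)
              (α β : CompleteOrderedField.Carrier ℝ) where

  open CompleteOrderedField ℝ
  open FieldProperties ℝ
  open Tropical lem ℝ α β

  supremum-unique : ∀ {I : Set} {f : I → Carrier} {s t} → IsSupremum f s → IsSupremum f t → s ≈ t
  supremum-unique (f≤s , s≤) (f≤t , t≤) = ≤-antisym (s≤ _ f≤t) (t≤ _ f≤s)

  sup-≈ : ∀ {I : Set} {f : I → Carrier} {s} → IsSupremum f s → sup f ≈ s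
  sup-≈ {f = f} is with lem {∃ (IsSupremum f)}
  ... | yes (_ , is′) = supremum-unique is′ is
  ... | no  none      = ⊥-elim (none (_ , is))

  inf-isInfimum : ∀ {I : Set} {f : I → Carrier} {s} → IsInfimum f s → IsInfimum f (inf f)
  inf-isInfimum {f = f} is with lem {∃ (IsInfimum f)}
  ... | yes (_ , is′) = is′
  ... | no  none      = ⊥-elim (none (_ , is))

  min-≈ : ∀ {I : Set} {f : I → Carrier} {s} → IsMinimum f s → min f ≈ s
  min-≈ {f = f} is@(s≤ , i , fi≈s) with lem {∃ (IsMinimum f)}
  ... | yes (_ , s′≤ , i′ , fi′≈s′) =
    ≤-antisym (≤-respʳ-≈ fi≈s (s′≤ i)) (≤-respʳ-≈ fi′≈s′ (s≤ i′))
  ... | no  none      = ⊥-elim (none (_ , is))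

  minimum⇒infimum : ∀ {I : Set} {f : I → Carrier} i → (∀ j → f i ≤ f j) → IsInfimum f (f i)
  minimum⇒infimum i fi≤ = fi≤ , λ _ l≤ → l≤ i

  -- The point at which the monomials of exponents v and suc v agree.
  corner : (ℤ → Carrier) → ℤ → Carrier
  corner a v = a v - a (ℤ.suc v)

  -- The one identity behind the next four comparisons: which of two adjacent monomials is smaller
  -- at `z` depends only on the side of the corner on which `z` lies.
  monomial-suc : ∀ a v z → monomial a (ℤ.suc v) z - monomial a v z ≈ z - corner a v
  monomial-suc a v z = trans
    (+-congʳ (+-congˡ (*-congˡ (fromℤ-+ (ℤ.+ 1) v))))
    (solve 4 (λ a a′ z f → (a′ :+ z :* (con (ℤ.+ 1) :+ f)) :- (a :+ z :* f) := z :- (a :- a′))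
       refl (a v) (a (ℤ.suc v)) z (fromℤ v))

  corner≤⇒ : ∀ a v {z} → corner a v ≤ z → monomial a v z ≤ monomial a (ℤ.suc v) z
  corner≤⇒ a v {z} c≤z = ≤-by (monomial-suc a v z) (0≤y-x c≤z)

  ⇒corner≤ : ∀ a v {z} → monomial a v z ≤ monomial a (ℤ.suc v) z → corner a v ≤ z
  ⇒corner≤ a v {z} m≤m = ≤-by (sym (monomial-suc a v z)) (0≤y-x m≤m)

  ≤corner⇒ : ∀ a v {z} → z ≤ corner a v → monomial a (ℤ.suc v) z ≤ monomial a v z
  ≤corner⇒ a v {z} z≤c = ≤-by
    (trans (solve 2 (λ x y → x :- y := :- (y :- x)) refl _ _)
      (trans (-‿cong (monomial-suc a v z)) (solve 2 (λ x y → :- (y :- x) := x :- y) refl _ _)))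
    (0≤y-x z≤c)

  ⇒≤corner : ∀ a v {z} → monomial a (ℤ.suc v) z ≤ monomial a v z → z ≤ corner a v
  ⇒≤corner a v {z} m≤m = ≤-by
    (trans (solve 2 (λ x y → x :- y := :- (y :- x)) refl _ _)
      (trans (-‿cong (sym (monomial-suc a v z))) (solve 2 (λ x y → :- (y :- x) := x :- y) refl _ _)))
    (0≤y-x m≤m)

  monomial-mono : ∀ {a b} v z → a v ≤ b v → monomial a v z ≤ monomial b v z
  monomial-mono {a} {b} v z av≤bv =
    ≤-by (solve 3 (λ a b t → (b :+ t) :- (a :+ t) := b :- a) refl (a v) (b v) (z * fromℤ v)) (0≤y-x av≤bv)

  Convex : (ℤ → Carrier) → Set
  Convex a = ∀ v → corner a (ℤ.suc v) ≤ corner a v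

  -- The exponent that attains the minimum at such a `z` is `ℤ.suc v`, not `v`: its two adjacent
  -- corners are those of `ℤ.suc v` and of `v`.
  record Located (a : ℤ → Carrier) (v : ℤ) (z : Carrier) : Set where
    constructor located
    field
      right : corner a (ℤ.suc v) ≤ z
      left  : z ≤ corner a v

  module _ {a : ℤ → Carrier} (convex : Convex a) where

    -- By convexity, once a corner is to the left of `z` so are the corners of all larger exponents,
    -- and each further step can only increase the monomial. `descend` is the mirror image.
    ascend : ∀ {v z} → corner a v ≤ z → ∀ k →
             corner a (ℤ.+ k ℤ.+ v) ≤ z × monomial a v z ≤ monomial a (ℤ.+ k ℤ.+ v) z
    ascend {v} c≤z zero rewrite ℤ.+-identityˡ v = c≤z , ≤-refl
    ascend {v} c≤z (suc k) with ascend c≤z k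
    ... | c≤z′ , m≤m rewrite ℤ.suc-+ k v =
      ≤-trans (convex _) c≤z′ , ≤-trans m≤m (corner≤⇒ a _ c≤z′)

    descend : ∀ {z} k w → z ≤ corner a (ℤ.+ k ℤ.+ w) →
              z ≤ corner a w × monomial a (ℤ.suc (ℤ.+ k ℤ.+ w)) z ≤ monomial a w z
    descend zero w z≤c rewrite ℤ.+-identityˡ w = z≤c , ≤corner⇒ a w z≤c
    descend (suc k) w z≤c rewrite ℤ.suc-+ k w with descend k w (≤-trans z≤c (convex _))
    ... | z≤c′ , m≤m = z≤c′ , ≤-trans (≤corner⇒ a _ z≤c) m≤m

    ascend-≤ : ∀ {v u z} → corner a v ≤ z → v ℤ.≤ u → monomial a v z ≤ monomial a u z
    ascend-≤ c≤z v≤u with ≤⇒offset v≤u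
    ... | k , ≡.refl = proj₂ (ascend c≤z k)

    descend-≤ : ∀ {v u z} → z ≤ corner a v → u ℤ.≤ ℤ.suc v → monomial a (ℤ.suc v) z ≤ monomial a u z
    descend-≤ {v} {u} z≤c u≤1+v with u ℤ.≟ ℤ.suc v
    ... | yes ≡.refl = ≤-refl
    ... | no  u≢1+v with ≤⇒offset (≡.subst (u ℤ.≤_) (ℤ.pred-suc v)
                                     (ℤ.i<j⇒i≤pred[j] (ℤ.≤∧≢⇒< u≤1+v u≢1+v)))
    ...   | k , ≡.refl = proj₂ (descend k u z≤c)

    located-minimal : ∀ {v z} → Located a v z → ∀ u → monomial a (ℤ.suc v) z ≤ monomial a u z
    located-minimal {v} (located right left) u with ℤ.<-cmp v u
    ... | tri< v<u _ _    = ascend-≤ right (ℤ.i<j⇒suc[i]≤j v<u)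
    ... | tri≈ _ ≡.refl _ = descend-≤ left (ℤ.i≤suc[i] v)
    ... | tri> _ _ u<v    = descend-≤ left (ℤ.i≤j⇒i≤1+j (ℤ.<⇒≤ u<v))

    -- A discrete intermediate value argument: the exponents are walked down from `ℤ.+ k ℤ.+ w`
    -- until the corner passes from the left of `z` to its right.
    locate : ∀ {z} k w → z ≤ corner a w → corner a (ℤ.+ k ℤ.+ w) ≤ z → ∃ λ v → Located a v z
    locate zero w z≤c c≤z rewrite ℤ.+-identityˡ w = w , located (≤-trans (convex w) c≤z) z≤c
    locate {z} (suc k) w z≤c c≤z rewrite ℤ.suc-+ k w with ≤-total z (corner a (ℤ.+ k ℤ.+ w))
    ... | inj₁ z≤c′ = _ , located c≤z z≤c′
    ... | inj₂ c′≤z = locate k w z≤c c′≤z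

  -- The canonical coefficients of the zero series.
  wall : ℤ → Carrier
  wall (ℤ.+ n)    = - (α * fromℤ (ℤ.+ n))
  wall (-[1+ n ]) = - (β * fromℤ (-[1+ n ]))

  corner-wall-+ : ∀ n → corner wall (ℤ.+ n) ≈ α
  corner-wall-+ n = trans (+-congˡ (-‿cong (-‿cong (*-congˡ (fromℤ-+ (ℤ.+ 1) (ℤ.+ n))))))
    (solve 2 (λ α f → (:- (α :* f)) :- (:- (α :* (con (ℤ.+ 1) :+ f))) := α) refl α (fromℤ (ℤ.+ n)))

  corner-wall-- : ∀ n → corner wall -[1+ n ] ≈ β
  corner-wall-- zero    =
    solve 2 (λ α β → (:- (β :* con -[1+ 0 ])) :- (:- (α :* con (ℤ.+ 0))) := β) refl α β
  corner-wall-- (suc n) = trans (+-congʳ (-‿cong (*-congˡ (trans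
      (solve 1 (λ f → f := (:- con (ℤ.+ 1)) :+ (con (ℤ.+ 1) :+ f)) refl (fromℤ -[1+ suc n ]))
      (+-congˡ (sym (fromℤ-+ (ℤ.+ 1) -[1+ suc n ])))))))
    (solve 2 (λ β f → (:- (β :* ((:- con (ℤ.+ 1)) :+ f))) :- (:- (β :* f)) := β) refl β (fromℤ -[1+ n ]))

-- A fixed upper bound for all coefficients, built as a sum of tents.

module Barriers (lem : ExcludedMiddle 0ℓ) (ℝ : CompleteOrderedField)
                (α β : CompleteOrderedField.Carrier ℝ) where

  open CompleteOrderedField ℝ
  open FieldProperties ℝ
  open Tropical lem ℝ α β
  open Series lem ℝ α β
  open Min totalOrder using (_⊓_; x⊓y≤x; x⊓y≤y; ⊓-sel; ⊓-glb)

  α≤corner-wall : α ≤ β → ∀ v → α ≤ corner wall v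
  α≤corner-wall α≤β (ℤ.+ n)    = ≤-reflexive (sym (corner-wall-+ n))
  α≤corner-wall α≤β (-[1+ n ]) = ≤-respʳ-≈ (sym (corner-wall-- n)) α≤β

  corner-wall≤β : α ≤ β → ∀ v → corner wall v ≤ β
  corner-wall≤β α≤β (ℤ.+ n)    = ≤-respˡ-≈ (sym (corner-wall-+ n)) α≤β
  corner-wall≤β α≤β (-[1+ n ]) = ≤-reflexive (corner-wall-- n)

  -- A series that lies above the zero series, has the same coefficients as it away
  -- from finitely many exponents, and is not smooth at any of the points p i.
  record Barrier {n : ℕ} (p : Fin n → Carrier) : Set where
    field
      h       : ℤ → Carrier
      N       : ℕ
      wall≤h  : ∀ v → wall v ≤ h v
      h≤wall⁺ : ∀ m → N ℕ.≤ m → h (ℤ.+ m) ≤ wall (ℤ.+ m)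
      h≤wall⁻ : ∀ m → N ℕ.≤ m → h -[1+ m ] ≤ wall -[1+ m ]
      rough   : ∀ i w → ∃ λ u → u ≢ w × monomial h u (p i) ≤ monomial h w (p i)

  -- The coefficients of H + (c ⊓ (z - α) ⊓ (β - z)), where H has coefficients h.
  addTent : Carrier → (ℤ → Carrier) → ℤ → Carrier
  addTent c h v = (h v + c) ⊓ ((h (ℤ.pred v) - α) ⊓ (h (ℤ.suc v) + β))

  addTent≤ : ∀ c h v → addTent c h v ≤ h v + c
  addTent≤ c h v = x⊓y≤x _ _

  addTent-suc≤ : ∀ c h v → addTent c h (ℤ.suc v) ≤ h v - α
  addTent-suc≤ c h v = ≡.subst (λ u → addTent c h (ℤ.suc v) ≤ h u - α) (ℤ.pred-suc v)
    (≤-trans (x⊓y≤y _ _) (x⊓y≤x _ _))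

  addTent-pred≤ : ∀ c h v → addTent c h (ℤ.pred v) ≤ h v + β
  addTent-pred≤ c h v = ≡.subst (λ u → addTent c h (ℤ.pred v) ≤ h u + β) (ℤ.suc-pred v)
    (≤-trans (x⊓y≤y _ _) (x⊓y≤y _ _))

  data Summand (c : Carrier) (h : ℤ → Carrier) (v : ℤ) : Set where
    top  : addTent c h v ≈ h v + c             → Summand c h v
    rise : addTent c h v ≈ h (ℤ.pred v) - α    → Summand c h v
    fall : addTent c h v ≈ h (ℤ.suc v) + β     → Summand c h v

  summand : ∀ c h v → Summand c h v
  summand c h v with ⊓-sel (h v + c) ((h (ℤ.pred v) - α) ⊓ (h (ℤ.suc v) + β))
  ... | inj₁ eq = top eq
  ... | inj₂ eq with ⊓-sel (h (ℤ.pred v) - α) (h (ℤ.suc v) + β)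
  ...   | inj₁ eq′ = rise (trans eq eq′)
  ...   | inj₂ eq′ = fall (trans eq eq′)

  fromℤ-suc : ∀ v → fromℤ (ℤ.suc v) ≈ fromℤ (ℤ.+ 1) + fromℤ v
  fromℤ-suc = fromℤ-+ (ℤ.+ 1)

  fromℤ-pred : ∀ v → fromℤ (ℤ.pred v) ≈ fromℤ -[1+ 0 ] + fromℤ v
  fromℤ-pred = fromℤ-+ -[1+ 0 ]

  suc≢ : ∀ {u w} → u ≢ ℤ.pred w → ℤ.suc u ≢ w
  suc≢ {u} u≢ ≡.refl = u≢ (≡.sym (ℤ.pred-suc u))

  pred≢ : ∀ {u w} → u ≢ ℤ.suc w → ℤ.pred u ≢ w
  pred≢ {u} u≢ ≡.refl = u≢ (≡.sym (ℤ.suc-pred u))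

  suc-≢ : ∀ w → ℤ.suc w ≢ w
  suc-≢ w = ℤ.i≢suc[i] ∘ ≡.sym

  pred-≢ : ∀ w → ℤ.pred w ≢ w
  pred-≢ w = pred≢ {w} ℤ.i≢suc[i]

  monomial-≤ : ∀ a u w {x y} z → a u ≤ x → a w ≈ y → x + z * fromℤ u ≤ y + z * fromℤ w →
               monomial a u z ≤ monomial a w z
  monomial-≤ a u w {x} {y} z au≤x aw≈y x≤y = ≤-trans
    (≤-by (solve 3 (λ x a t → (x :+ t) :- (a :+ t) := x :- a) refl x (a u) (z * fromℤ u)) (0≤y-x au≤x))
    (≤-respʳ-≈ (+-congʳ (sym aw≈y)) x≤y)

  -- Adding a concave function does not smooth a corner. Whichever of the three terms gives the
  -- coefficient at `w`, roughness of `h` at the correspondingly shifted exponent yields a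
  -- competitor, and shifting it back by the same term gives one for `addTent c h`.
  addTent-preserves-rough : ∀ c h z → (∀ w → ∃ λ u → u ≢ w × monomial h u z ≤ monomial h w z) →
    ∀ w → ∃ λ u → u ≢ w × monomial (addTent c h) u z ≤ monomial (addTent c h) w z
  addTent-preserves-rough c h z rough w with summand c h w
  ... | top eq with rough w
  ...   | u , u≢w , m≤m = u , u≢w , monomial-≤ (addTent c h) u w z (addTent≤ c h u) eq (≤-by
    (solve 5 (λ c x y s t → (y :+ c :+ t) :- (x :+ c :+ s) := (y :+ t) :- (x :+ s)) refl
      c (h u) (h w) (z * fromℤ u) (z * fromℤ w)) (0≤y-x m≤m))
  addTent-preserves-rough c h z rough w | rise eq with rough (ℤ.pred w)
  ...   | u , u≢ , m≤m = ℤ.suc u , suc≢ u≢ , monomial-≤ (addTent c h) (ℤ.suc u) w z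
    (addTent-suc≤ c h u) eq (≤-by
    (trans (+-congˡ (-‿cong (+-congˡ (*-congˡ (fromℤ-suc u)))))
      (trans (solve 6 (λ α x y z s t → (y :- α :+ z :* t) :- (x :- α :+ z :* (con (ℤ.+ 1) :+ s))
                          := (y :+ z :* (con -[1+ 0 ] :+ t)) :- (x :+ z :* s)) refl
        α (h u) (h (ℤ.pred w)) z (fromℤ u) (fromℤ w))
        (+-congʳ (+-congˡ (*-congˡ (sym (fromℤ-pred w)))))))
    (0≤y-x m≤m))
  addTent-preserves-rough c h z rough w | fall eq with rough (ℤ.suc w)
  ...   | u , u≢ , m≤m = ℤ.pred u , pred≢ u≢ , monomial-≤ (addTent c h) (ℤ.pred u) w z
    (addTent-pred≤ c h u) eq (≤-by
    (trans (+-congˡ (-‿cong (+-congˡ (*-congˡ (fromℤ-pred u)))))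
      (trans (solve 6 (λ β x y z s t → (y :+ β :+ z :* t) :- (x :+ β :+ z :* (con -[1+ 0 ] :+ s))
                          := (y :+ z :* (con (ℤ.+ 1) :+ t)) :- (x :+ z :* s)) refl
        β (h u) (h (ℤ.suc w)) z (fromℤ u) (fromℤ w))
        (+-congʳ (+-congˡ (*-congˡ (sym (fromℤ-suc w)))))))
    (0≤y-x m≤m))

  -- The height `c` is the smaller of the two slanted sides at `z`, so that the flat top meets a
  -- side exactly there. A coefficient coming from a side therefore competes with the top, and one
  -- coming from the top competes with the side that it meets.
  addTent-rough : ∀ h z → let c = (z - α) ⊓ (β - z) in
    ∀ w → ∃ λ u → u ≢ w × monomial (addTent c h) u z ≤ monomial (addTent c h) w z
  addTent-rough h z w with summand ((z - α) ⊓ (β - z)) h w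
  ... | rise eq = ℤ.pred w , pred-≢ w , monomial-≤ (addTent c h) (ℤ.pred w) w z
    (addTent≤ c h (ℤ.pred w)) eq (≤-by
    (trans (+-congˡ (-‿cong (+-congˡ (*-congˡ (fromℤ-pred w)))))
      (solve 5 (λ α x c z t → (x :- α :+ z :* t) :- (x :+ c :+ z :* (con -[1+ 0 ] :+ t))
                   := (z :- α) :- c) refl α (h (ℤ.pred w)) c z (fromℤ w)))
    (0≤y-x (x⊓y≤x _ _)))
    where c = (z - α) ⊓ (β - z)
  ... | fall eq = ℤ.suc w , suc-≢ w , monomial-≤ (addTent c h) (ℤ.suc w) w z
    (addTent≤ c h (ℤ.suc w)) eq (≤-by
    (trans (+-congˡ (-‿cong (+-congˡ (*-congˡ (fromℤ-suc w)))))
      (solve 5 (λ β x c z t → (x :+ β :+ z :* t) :- (x :+ c :+ z :* (con (ℤ.+ 1) :+ t))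
                   := (β :- z) :- c) refl β (h (ℤ.suc w)) c z (fromℤ w)))
    (0≤y-x (x⊓y≤y _ _)))
    where c = (z - α) ⊓ (β - z)
  ... | top eq with ⊓-sel (z - α) (β - z)
  ...   | inj₁ c≈ = ℤ.suc w , suc-≢ w , monomial-≤ (addTent c h) (ℤ.suc w) w z
    (addTent-suc≤ c h w) (trans eq (+-congˡ c≈))
    (≤-reflexive (trans (+-congˡ (*-congˡ (fromℤ-suc w)))
      (solve 4 (λ α x z t → x :- α :+ z :* (con (ℤ.+ 1) :+ t) := x :+ (z :- α) :+ z :* t) refl
        α (h w) z (fromℤ w))))
    where c = (z - α) ⊓ (β - z)
  ...   | inj₂ c≈ = ℤ.pred w , pred-≢ w , monomial-≤ (addTent c h) (ℤ.pred w) w z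
    (addTent-pred≤ c h w) (trans eq (+-congˡ c≈))
    (≤-reflexive (trans (+-congˡ (*-congˡ (fromℤ-pred w)))
      (solve 4 (λ β x z t → x :+ β :+ z :* (con -[1+ 0 ] :+ t) := x :+ (β :- z) :+ z :* t) refl
        β (h w) z (fromℤ w))))
    where c = (z - α) ⊓ (β - z)

  barrier : α ≤ β → ∀ {n} (p : Fin n → Carrier) → (∀ i → α ≤ p i × p i ≤ β) → Barrier p
  barrier α≤β {zero} p p∈Ω = record
    { h       = wall
    ; N       = 0
    ; wall≤h  = λ _ → ≤-refl
    ; h≤wall⁺ = λ _ _ → ≤-refl
    ; h≤wall⁻ = λ _ _ → ≤-refl
    ; rough   = λ ()
    }
  barrier α≤β {suc n} p p∈Ω = record
    { h       = addTent c h
    -- The tent has exponents -1, 0 and 1, so agreement with `wall` begins one exponent later on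
    -- either side.
    ; N       = suc N
    -- The zero series lies below each of the three terms: `c` is non-negative, and the corners of
    -- `wall` lie between `α` and `β`.
    ; wall≤h  = λ v → ⊓-glb
        (≤-trans (wall≤h v) (≤-by (solve 2 (λ x c → (x :+ c) :- x := c) refl _ _) 0≤c))
        (⊓-glb
          (≤-trans (wall-rise v) (≤-by
            (solve 3 (λ x y α → (y :- α) :- (x :- α) := y :- x) refl _ _ _)
            (0≤y-x (wall≤h (ℤ.pred v)))))
          (≤-trans (wall-fall v) (≤-by
            (solve 3 (λ x y β → (y :+ β) :- (x :+ β) := y :- x) refl _ _ _)
            (0≤y-x (wall≤h (ℤ.suc v))))))
    ; h≤wall⁺ = λ where
        (suc m) (s≤s N≤m) → ≤-trans (addTent-suc≤ c h (ℤ.+ m)) (≤-by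
          (trans (+-congʳ (solve 2 (λ x y → y := x :- (x :- y)) refl (wall (ℤ.+ m)) (wall (ℤ.+ suc m))))
            (trans (+-congʳ (+-congˡ (-‿cong (corner-wall-+ m))))
              (solve 3 (λ x y α → (x :- α) :- (y :- α) := x :- y) refl _ _ _)))
          (0≤y-x (h≤wall⁺ m N≤m)))
    ; h≤wall⁻ = λ where
        (suc m) (s≤s N≤m) → ≤-trans (addTent-pred≤ c h -[1+ m ]) (≤-by
          (trans (+-congʳ (solve 2 (λ x y → y := x :+ (y :- x)) refl (wall -[1+ m ]) (wall -[1+ suc m ])))
            (trans (+-congʳ (+-congˡ (corner-wall-- (suc m))))
              (solve 3 (λ x y β → (x :+ β) :- (y :+ β) := x :- y) refl _ _ _)))
          (0≤y-x (h≤wall⁻ m N≤m)))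
    ; rough   = λ where
        zero    → addTent-rough h (p zero)
        (suc i) → addTent-preserves-rough c h (p (suc i)) (rough i)
    }
    where
    open Barrier (barrier α≤β (p ∘ suc) (p∈Ω ∘ suc))
    c : Carrier
    c = (p zero - α) ⊓ (β - p zero)
    0≤c : 0# ≤ c
    0≤c = ⊓-glb (0≤y-x (proj₁ (p∈Ω zero))) (0≤y-x (proj₂ (p∈Ω zero)))
    wall-rise : ∀ v → wall v ≤ wall (ℤ.pred v) - α
    wall-rise v = ≡.subst (λ u → wall u ≤ wall (ℤ.pred v) - α) (ℤ.suc-pred v)
      (≤-by (solve 3 (λ x y α → (x :- α) :- y := (x :- y) :- α) refl _ _ _)
            (0≤y-x (α≤corner-wall α≤β (ℤ.pred v))))
    wall-fall : ∀ v → wall v ≤ wall (ℤ.suc v) + β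
    wall-fall v = ≤-by (solve 3 (λ x y β → (y :+ β) :- x := β :- (x :- y)) refl _ _ _)
                       (0≤y-x (corner-wall≤β α≤β v))

-- Local form of a series at a point.

module Relaxation (lem : ExcludedMiddle 0ℓ) (ℝ : CompleteOrderedField)
                  (α β : CompleteOrderedField.Carrier ℝ)
                  (α≤β : CompleteOrderedField._≤_ ℝ α β) where

  open CompleteOrderedField ℝ
  open FieldProperties ℝ
  open Halving ℝ
  open Tropical lem ℝ α β
  open Series lem ℝ α β
  open Barriers lem ℝ α β
  open Max totalOrder using (⊔-sel)
  open Min totalOrder using (_⊓_; x⊓y≤x; x⊓y≤y; ⊓-sel)

  0<⊓ : ∀ {x y} → 0# < x → 0# < y → 0# < x ⊓ y
  0<⊓ {x} {y} 0<x 0<y = [ (λ eq → <-≤-trans 0<x (≤-reflexive (sym eq)))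
                        , (λ eq → <-≤-trans 0<y (≤-reflexive (sym eq))) ]′ (⊓-sel x y)

  ∣∣-< : ∀ {x δ} → x < δ → - x < δ → ∣ x ∣ < δ
  ∣∣-< {x} x<δ -x<δ = [ (λ eq → ≤-<-trans (≤-reflexive eq) x<δ)
                      , (λ eq → ≤-<-trans (≤-reflexive eq) -x<δ) ]′ (⊔-sel x (- x))

  Represents : (ℤ → Carrier) → (Ω → Carrier) → Set
  Represents a F = ∀ z → IsInfimum (λ v → monomial a v (proj₁ z)) (F z)

  -- The monomial of exponent `ℤ.suc v` still gives `F` at `p - t` and `p + t`, so there it is at
  -- most both neighbouring monomials. This puts the two adjacent corners at or beyond these points,
  -- hence strictly on either side of `p`.
  near⇒between : ∀ {F} (p : Ω°) v → Represents (coefficient F) F → IsMonomialNear F p (ℤ.suc v) →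
    corner (coefficient F) (ℤ.suc v) < proj₁ p × proj₁ p < corner (coefficient F) v
  near⇒between {F} (p , α<p , p<β) v rep (δ , 0<δ , near) =
      ≤-<-trans (⇒corner≤ a (ℤ.suc v) (≤-respˡ-≈ (near p- p-near) (proj₁ (rep p-) (ℤ.suc (ℤ.suc v))))) p-t<p
    , <-≤-trans p<p+t (⇒≤corner a v (≤-respˡ-≈ (near p+ p+near) (proj₁ (rep p+) v)))
    where
    a = coefficient F
    0<β-p = 0<y-x p<β
    0<p-α = 0<y-x α<p
    -- Half of this radius keeps both points inside Ω and strictly closer to `p` than `δ`.
    r = δ ⊓ ((β - p) ⊓ (p - α))
    0<r : 0# < r
    0<r = 0<⊓ 0<δ (0<⊓ 0<β-p 0<p-α)
    t = half r
    0<t : 0# < t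
    0<t = 0<half 0<r
    t<r : t < r
    t<r = half< 0<r
    t<δ : t < δ
    t<δ = <-≤-trans t<r (x⊓y≤x _ _)
    -t<δ : - t < δ
    -t<δ = ≤-<-trans (≤-by (solve 1 (λ t → con (ℤ.+ 0) :- (:- t) := t :- con (ℤ.+ 0)) refl t)
                           (0≤y-x (<⇒≤ 0<t))) 0<δ
    t≤β-p : t ≤ β - p
    t≤β-p = ≤-trans (<⇒≤ t<r) (≤-trans (x⊓y≤y _ _) (x⊓y≤x _ _))
    t≤p-α : t ≤ p - α
    t≤p-α = ≤-trans (<⇒≤ t<r) (≤-trans (x⊓y≤y _ _) (x⊓y≤y _ _))
    p<p+t : p < p + t
    p<p+t = <-by (solve 2 (λ p t → (p :+ t) :- p := (t :- con (ℤ.+ 0)) :+ con (ℤ.+ 0)) refl p t) 0<t ≤-refl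
    p-t<p : p - t < p
    p-t<p = <-by (solve 2 (λ p t → p :- (p :- t) := (t :- con (ℤ.+ 0)) :+ con (ℤ.+ 0)) refl p t) 0<t ≤-refl
    p+ p- : Ω
    p+ = p + t , ≤-trans (<⇒≤ α<p) (<⇒≤ p<p+t)
       , ≤-by (solve 3 (λ β p t → β :- (p :+ t) := (β :- p) :- t) refl β p t) (0≤y-x t≤β-p)
    p- = p - t
       , ≤-by (solve 3 (λ α p t → (p :- t) :- α := (p :- α) :- t) refl α p t) (0≤y-x t≤p-α)
       , ≤-trans (<⇒≤ p-t<p) (<⇒≤ p<β)
    p+near : ∣ (p + t) - p ∣ < δ
    p+near = ∣∣-<
      (≤-<-trans (≤-reflexive (solve 2 (λ p t → (p :+ t) :- p := t) refl p t)) t<δ)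
      (≤-<-trans (≤-reflexive (solve 2 (λ p t → :- ((p :+ t) :- p) := :- t) refl p t)) -t<δ)
    p-near : ∣ (p - t) - p ∣ < δ
    p-near = ∣∣-<
      (≤-<-trans (≤-reflexive (solve 2 (λ p t → (p :- t) :- p := :- t) refl p t)) -t<δ)
      (≤-<-trans (≤-reflexive (solve 2 (λ p t → :- ((p :- t) :- p) := t) refl p t)) t<δ)

  -- The invariant of the relaxation and its preservation by one raise.

  module Confined {n : ℕ} {points : Fin n → Carrier} (B : Barrier points) where

    open Barrier B

    -- Convexity and corners inside Ω make the coefficients canonical. The bounds `wall` and `h`
    -- meet outside finitely many exponents, which makes the infimum over all of ℤ a minimum.
    record Confinement (a : ℤ → Carrier) : Set where
      field
        convex   : Convex a
        α≤corner : ∀ v → α ≤ corner a v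
        corner≤β : ∀ v → corner a v ≤ β
        wall≤a   : ∀ v → wall v ≤ a v
        a≤h      : ∀ v → a v ≤ h v

    confinement-resp-≈ : ∀ {a b} → (∀ v → a v ≈ b v) → Confinement a → Confinement b
    confinement-resp-≈ {a} {b} a≈b conf = record
      { convex   = λ v → ≤-resp-≈ (corner-≈ _) (corner-≈ v) (convex v)
      ; α≤corner = λ v → ≤-respʳ-≈ (corner-≈ v) (α≤corner v)
      ; corner≤β = λ v → ≤-respˡ-≈ (corner-≈ v) (corner≤β v)
      ; wall≤a   = λ v → ≤-respʳ-≈ (a≈b v) (wall≤a v)
      ; a≤h      = λ v → ≤-respˡ-≈ (a≈b v) (a≤h v)
      }
      where
      open Confinement conf
      corner-≈ : ∀ v → corner a v ≈ corner b v
      corner-≈ v = +-cong (a≈b v) (-‿cong (a≈b (ℤ.suc v)))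

    module _ {a : ℤ → Carrier} (conf : Confinement a) where
      open Confinement conf

      find : ∀ (z : Ω) → ∃ λ v → Located a v (proj₁ z)
      find (z , α≤z , z≤β) with ≤⇒offset {lo} {hi} ℤ.-≤+
        where
        -- A corner involves two adjacent coefficients. At `lo` and `hi` the one that must be
        -- bounded above has an exponent where `h` is at most `wall`; the other is bounded below by
        -- `wall`. So these corners are at least `β` and at most `α`.
        lo = -[1+ suc N ]
        hi = ℤ.+ N
      ... | k , hi≡ = locate convex k -[1+ suc N ] (≤-trans z≤β β≤corner)
        (≡.subst (λ u → corner a u ≤ z) hi≡ (≤-trans corner≤α α≤z))
        where
        β≤corner : β ≤ corner a -[1+ suc N ]
        β≤corner = ≤-respˡ-≈ (corner-wall-- (suc N)) (≤-by
          (solve 4 (λ x y x′ y′ → (x′ :- y′) :- (x :- y) := (x′ :- x) :+ (y :- y′)) refl _ _ _ _)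
          (0≤-+ (0≤y-x (wall≤a -[1+ suc N ]))
                (0≤y-x (≤-trans (a≤h -[1+ N ]) (h≤wall⁻ N ℕ.≤-refl)))))
        corner≤α : corner a (ℤ.+ N) ≤ α
        corner≤α = ≤-respʳ-≈ (corner-wall-+ N) (≤-by
          (solve 4 (λ x y x′ y′ → (x′ :- y′) :- (x :- y) := (x′ :- x) :+ (y :- y′)) refl _ _ _ _)
          (0≤-+ (0≤y-x (≤-trans (a≤h (ℤ.+ N)) (h≤wall⁺ N ℕ.≤-refl)))
                (0≤y-x (wall≤a (ℤ.+ suc N)))))

      infimum : ∀ (z : Ω) → ∃ (IsInfimum λ v → monomial a v (proj₁ z))
      infimum z = let v , loc = find z in
        monomial a (ℤ.suc v) (proj₁ z) ,
        minimum⇒infimum {f = λ u → monomial a u (proj₁ z)} (ℤ.suc v) (located-minimal convex loc)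

      -- The supremum defining the coefficient of exponent suc v is attained at
      -- corner a (suc v).
      coefficient-suc-≈ : ∀ {F} → Represents a F → ∀ v → coefficient F (ℤ.suc v) ≈ a (ℤ.suc v)
      coefficient-suc-≈ {F} rep v = sup-≈
        ( (λ z → ≤-by
            (solve 3 (λ a t f → a :- (f :- t) := (a :+ t) :- f) refl _ _ _)
            (0≤y-x (proj₁ (rep z) w)))
        , λ u ub → ≤-trans
            (≤-by (solve 3 (λ a t f → (f :- t) :- a := f :- (a :+ t)) refl _ _ _)
                  (0≤y-x (proj₂ (rep x) (monomial a w (proj₁ x)) (located-minimal convex at-corner))))
            (ub x))
        where
        w = ℤ.suc v
        x : Ω
        x = corner a w , α≤corner w , corner≤β w
        at-corner : Located a v (proj₁ x)
        at-corner = located ≤-refl (convex v)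

      coefficient-≈ : ∀ {F} → Represents a F → ∀ v → coefficient F v ≈ a v
      coefficient-≈ {F} rep v =
        ≡.subst (λ u → coefficient F u ≈ a u) (ℤ.suc-pred v) (coefficient-suc-≈ rep (ℤ.pred v))

    record Tame (F : Ω → Carrier) : Set where
      field
        represents  : Represents (coefficient F) F
        confinement : Confinement (coefficient F)

    -- Confined coefficients agree with the canonical ones, so the invariant carries over to
    -- `coefficient F`, the sequence that `G` acts on.
    represented⇒tame : ∀ {a F} → Confinement a → Represents a F → Tame F
    represented⇒tame {a} {F} conf rep = record
      { represents = λ z →
            (λ v → ≤-respʳ-≈ (+-congʳ (sym (coefficient-≈ conf rep v))) (proj₁ (rep z) v))
          , (λ l l≤ → proj₂ (rep z) l λ v → ≤-respʳ-≈ (+-congʳ (coefficient-≈ conf rep v)) (l≤ v))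
      ; confinement = confinement-resp-≈ (λ v → sym (coefficient-≈ conf rep v)) conf
      }

    zero-tame : Tame 0Ω
    zero-tame = represented⇒tame conf rep
      where
      conf : Confinement wall
      conf = record
        { convex   = convex
        ; α≤corner = α≤corner-wall α≤β
        ; corner≤β = corner-wall≤β α≤β
        ; wall≤a   = λ _ → ≤-refl
        ; a≤h      = wall≤h
        }
        where
        convex : Convex wall
        convex (ℤ.+ n)        = ≤-reflexive (trans (corner-wall-+ (suc n)) (sym (corner-wall-+ n)))
        convex -[1+ zero ]    = ≤-resp-≈ (sym (corner-wall-+ 0)) (sym (corner-wall-- 0)) α≤β
        convex -[1+ suc n ]   = ≤-reflexive (trans (corner-wall-- n) (sym (corner-wall-- (suc n))))
      rep : Represents wall 0Ω
      rep (z , α≤z , z≤β) =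
          (λ v → ≤-respˡ-≈ value (located-minimal (Confinement.convex conf) at-0 v))
        , (λ l l≤ → ≤-respʳ-≈ value (l≤ (ℤ.+ 0)))
        where
        value : monomial wall (ℤ.+ 0) z ≈ 0#
        value = solve 2 (λ α z → (:- (α :* con (ℤ.+ 0))) :+ z :* con (ℤ.+ 0) := con (ℤ.+ 0)) refl α z
        -- Exponent 0 is the successor of -1; its adjacent corners are `α` and `β`, so it is minimal
        -- on all of Ω.
        at-0 : Located wall -[1+ 0 ] z
        at-0 = located (≤-respˡ-≈ (sym (corner-wall-+ 0)) α≤z) (≤-respʳ-≈ (sym (corner-wall-- 0)) z≤β)

    -- The counterpart of `Move` over ℤ. Corners decrease as the exponent grows, so corner `ℤ.suc v`
    -- is the particle to the left of `p` and corner `v` the one to its right.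
    record Raise (p : Carrier) (a b : ℤ → Carrier) : Set where
      field
        v      : ℤ
        raised : a (ℤ.suc v) < b (ℤ.suc v)
        others : ∀ u → u ≢ ℤ.suc v → b u ≈ a u
        lands  : (corner a (ℤ.suc v) < p × corner b (ℤ.suc v) ≈ p) ⊎
                 (p < corner a v × corner b v ≈ p)

    raise-other : ∀ a w p {u} → u ≢ w → raise a w p u ≡ a u
    raise-other a w p {u} u≢w with u ℤ.≟ w
    ... | no  _   = ≡.refl
    ... | yes u≡w = ⊥-elim (u≢w u≡w)

    raise-at : ∀ a w p → raise a w p w ≡
               min (λ ((u , _) : ∃ λ u → u ≢ w) → monomial a u p) - p * fromℤ w
    raise-at a w p with w ℤ.≟ w
    ... | yes _   = ≡.refl
    ... | no  w≢w = ⊥-elim (w≢w ≡.refl)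

    module _ {a : ℤ → Carrier} (conf : Confinement a) (i : Fin n) (v : ℤ)
             (right : corner a (ℤ.suc v) < points i) (left : points i < corner a v) where

      open Confinement conf

      private
        p = points i
        w = ℤ.suc v
        b = raise a w p

        v≢w : v ≢ w
        v≢w = ℤ.i≢suc[i]

        suc-w≢w : ℤ.suc w ≢ w
        suc-w≢w = suc-≢ w

        -- By convexity, among the exponents other than `w` the minimum at `p` is attained at one of
        -- the two neighbours of `w`.
        others-≤ : (x : Carrier) → x ≤ monomial a (ℤ.suc w) p → x ≤ monomial a v p →
                   ∀ u → u ≢ w → x ≤ monomial a u p
        others-≤ x x≤sw x≤v u u≢w with ℤ.<-cmp w u
        ... | tri< w<u _ _ = ≤-trans x≤sw
          (ascend-≤ convex (≤-trans (convex w) (<⇒≤ right)) (ℤ.i<j⇒suc[i]≤j w<u))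
        ... | tri≈ _ w≡u _ = ⊥-elim (u≢w (≡.sym w≡u))
        ... | tri> _ _ u<w = ≤-trans x≤v (≡.subst (λ s → monomial a s p ≤ monomial a u p) (ℤ.suc-pred v)
          (descend-≤ convex
            (≤-trans (<⇒≤ left) (≡.subst (λ s → corner a s ≤ corner a (ℤ.pred v)) (ℤ.suc-pred v)
              (convex (ℤ.pred v))))
            (≡.subst (u ℤ.≤_) (≡.trans (ℤ.pred-suc v) (≡.sym (ℤ.suc-pred v)))
              (ℤ.i<j⇒i≤pred[j] u<w))))

        b≈a : ∀ u → u ≢ w → b u ≈ a u
        b≈a u u≢w = reflexive (raise-other a w p u≢w)

        monomial-b≈a : ∀ u → u ≢ w → monomial b u p ≈ monomial a u p
        monomial-b≈a u u≢w = +-congʳ (b≈a u u≢w)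

        b-at-w : ∀ {m} → IsMinimum (λ ((u , _) : ∃ λ u → u ≢ w) → monomial a u p) m →
                 monomial b w p ≈ m
        b-at-w isMin = trans (+-congʳ (reflexive (raise-at a w p)))
          (trans (solve 2 (λ m t → (m :- t) :+ t := m) refl _ _) (min-≈ isMin))

        -- The raised monomial takes at `p` the smallest value of the others: it remains minimal and
        -- ties with a neighbour, which puts a corner at `p`. Exhibiting the neighbour that attains
        -- the minimum also ensures that `min` returns it and not the default `0#`.
        minimum : (∀ u → u ≢ w → monomial b w p ≤ monomial b u p) ×
                  (monomial b (ℤ.suc w) p ≤ monomial b w p ⊎ monomial b v p ≤ monomial b w p)
        minimum with ≤-total (monomial a (ℤ.suc w) p) (monomial a v p)
        ... | inj₁ sw≤v = (λ u u≢w → ≤-resp-≈ (sym eq) (sym (monomial-b≈a u u≢w)) (minimal u u≢w))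
                        , inj₁ (≤-reflexive (trans (monomial-b≈a (ℤ.suc w) suc-w≢w) (sym eq)))
          where
          minimal = others-≤ _ ≤-refl sw≤v
          eq = b-at-w ((λ (u , u≢w) → minimal u u≢w) , (ℤ.suc w , suc-w≢w) , refl)
        ... | inj₂ v≤sw = (λ u u≢w → ≤-resp-≈ (sym eq) (sym (monomial-b≈a u u≢w)) (minimal u u≢w))
                        , inj₂ (≤-reflexive (trans (monomial-b≈a v v≢w) (sym eq)))
          where
          minimal = others-≤ _ v≤sw ≤-refl
          eq = b-at-w ((λ (u , u≢w) → minimal u u≢w) , (v , v≢w) , refl)

        corner-b-w≤p : corner b w ≤ p
        corner-b-w≤p = ⇒corner≤ b w (proj₁ minimum (ℤ.suc w) suc-w≢w)

        p≤corner-b-v : p ≤ corner b v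
        p≤corner-b-v = ⇒≤corner b v (proj₁ minimum v v≢w)

        lands : (corner a w < p × corner b w ≈ p) ⊎ (p < corner a v × corner b v ≈ p)
        lands with proj₂ minimum
        ... | inj₁ sw≤w = inj₁ (right , ≤-antisym corner-b-w≤p (⇒≤corner b w sw≤w))
        ... | inj₂ v≤w  = inj₂ (left , ≤-antisym (⇒corner≤ b v v≤w) p≤corner-b-v)

        -- The landing corner moves strictly, and of the two coefficients that define it only the
        -- one at `w` changes.
        raised : a w < b w
        raised with lands
        ... | inj₁ (c<p , c≈p) = <-by
          (trans (solve 3 (λ a b c → b :- a := (b :- c) :- (a :- c) :+ con (ℤ.+ 0)) refl _ _ _)
            (+-congʳ (+-congʳ (trans (+-congˡ (-‿cong (sym (b≈a (ℤ.suc w) suc-w≢w)))) c≈p))))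
          c<p ≤-refl
        ... | inj₂ (p<c , c≈p) = <-by
          (trans (solve 3 (λ a b c → b :- a := (c :- a) :- (c :- b) :+ con (ℤ.+ 0)) refl _ _ _)
            (+-congʳ (+-congˡ (-‿cong (trans (+-congʳ (sym (b≈a v v≢w))) c≈p)))))
          p<c ≤-refl

      raise-raises : Raise p a b
      raise-raises = record { v = v ; raised = raised ; others = b≈a ; lands = lands }

      raise-confined : Confinement b
      raise-confined = record
        { convex   = convex-b
        ; α≤corner = α≤corner-b
        ; corner≤β = corner-b≤β
        ; wall≤a   = λ u → ≤-trans (wall≤a u) (a≤b u)
        ; a≤h      = b≤h
        }
        where
        a≤b : ∀ u → a u ≤ b u
        a≤b u = by-cases (u ℤ.≟ w)
          where
          by-cases : Dec (u ≡ w) → a u ≤ b u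
          by-cases (yes ≡.refl) = <⇒≤ raised
          by-cases (no  u≢w)    = ≤-reflexive (sym (b≈a u u≢w))
        grows : ∀ u → u ≢ v → corner a u ≤ corner b u
        grows u u≢v = ≤-by
          (trans (+-congʳ (+-congˡ (-‿cong (b≈a (ℤ.suc u) (λ eq → u≢v (≡.trans
            (≡.sym (ℤ.pred-suc u)) (≡.trans (≡.cong ℤ.pred eq) (ℤ.pred-suc v))))))))
            (solve 3 (λ a b c → (b :- c) :- (a :- c) := b :- a) refl _ _ _))
          (0≤y-x (a≤b u))
        shrinks : ∀ u → u ≢ w → corner b u ≤ corner a u
        shrinks u u≢w = ≤-by
          (trans (+-congˡ (-‿cong (+-congʳ (b≈a u u≢w))))
            (solve 3 (λ a b c → (c :- a) :- (c :- b) := b :- a) refl _ _ _))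
          (0≤y-x (a≤b (ℤ.suc u)))
        -- Only corner `v` can move left and only corner `w` can move right. These two are
        -- consecutive, and `p` still separates them.
        convex-b : Convex b
        convex-b u with u ℤ.≟ v
        ... | yes ≡.refl = ≤-trans corner-b-w≤p p≤corner-b-v
        ... | no  u≢v = ≤-trans (shrinks (ℤ.suc u) (λ eq → u≢v (≡.trans
            (≡.sym (ℤ.pred-suc u)) (≡.trans (≡.cong ℤ.pred eq) (ℤ.pred-suc v)))))
          (≤-trans (convex u) (grows u u≢v))
        α≤corner-b : ∀ u → α ≤ corner b u
        α≤corner-b u with u ℤ.≟ v
        ... | yes ≡.refl = ≤-trans (≤-trans (α≤corner w) (<⇒≤ right)) p≤corner-b-v
        ... | no  u≢v    = ≤-trans (α≤corner u) (grows u u≢v)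
        corner-b≤β : ∀ u → corner b u ≤ β
        corner-b≤β u = by-cases (u ℤ.≟ w)
          where
          by-cases : Dec (u ≡ w) → corner b u ≤ β
          by-cases (yes ≡.refl) = ≤-trans corner-b-w≤p (≤-trans (<⇒≤ left) (corner≤β v))
          by-cases (no  u≢w)    = ≤-trans (shrinks u u≢w) (corner≤β u)
        -- At `w` the roughness of the barrier at `p` supplies another exponent `u′` whose
        -- `h`-monomial is no larger there. The raised monomial is at most the one of `a` at `u′`,
        -- hence at most that `h`-monomial, so the raise stops below `h w`.
        b≤h : ∀ u → b u ≤ h u
        b≤h u = by-cases (u ℤ.≟ w)
          where
          by-cases : Dec (u ≡ w) → b u ≤ h u
          by-cases (no  u≢w)    = ≤-respˡ-≈ (sym (b≈a u u≢w)) (a≤h u)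
          by-cases (yes ≡.refl) with rough i w
          ... | u′ , u′≢w , u′≤w = ≤-by
            (solve 3 (λ b h t → h :- b := (h :+ t) :- (b :+ t)) refl _ _ (p * fromℤ w))
            (0≤y-x (≤-trans (proj₁ minimum u′ u′≢w)
              (≤-trans (≤-reflexive (monomial-b≈a u′ u′≢w))
                (≤-trans (monomial-mono {a} {h} u′ p (a≤h u′)) u′≤w))))

-- Listing the exponents by natural numbers.

suc[m⊖1+n]≡m⊖n : ∀ m n → ℤ.suc (m ⊖ suc n) ≡ m ⊖ n
suc[m⊖1+n]≡m⊖n m n = ≡.trans (ℤ.distribʳ-⊖-+-pos 1 m (suc n)) (ℤ.[1+m]⊖[1+n]≡m⊖n m n)

suc-injective : ∀ {i j} → ℤ.suc i ≡ ℤ.suc j → i ≡ j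
suc-injective {i} {j} = +-cancelˡ ℤ.1ℤ i j

⊖-injectiveʳ : ∀ m {n o} → m ⊖ n ≡ m ⊖ o → n ≡ o
⊖-injectiveʳ m {n} {o} eq = ℤ.+-injective (ℤ.neg-injective (+-cancelˡ (ℤ.+ m) (ℤ.- (ℤ.+ n)) (ℤ.- (ℤ.+ o))
  (≡.trans (ℤ.m-n≡m⊖n m n) (≡.trans eq (≡.sym (ℤ.m-n≡m⊖n m o))))))

-- The remaining exponents are `N - 1` down to `- N`. These 2N exponents have 2N + 1 adjacent
-- corners, which is the number of particles used later.
⊖-covers : ∀ N w → (∀ m → N ℕ.≤ m → w ≢ ℤ.+ m) → (∀ m → N ℕ.≤ m → w ≢ -[1+ m ]) →
           ∃ λ j → suc (suc j) ℕ.≤ suc (N ℕ.+ N) × N ⊖ suc j ≡ w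
⊖-covers N (ℤ.+ m) w≢+ w≢- =
    N ∸ suc m
  , s≤s (ℕ.≤-trans (ℕ.≤-reflexive 1+[N∸1+m]≡N∸m) (ℕ.≤-trans (ℕ.m∸n≤m N m) (ℕ.m≤m+n N N)))
  , ≡.trans (≡.cong (N ⊖_) 1+[N∸1+m]≡N∸m)
      (≡.trans (ℤ.⊖-≥ (ℕ.m∸n≤m N m)) (≡.cong ℤ.+_ (ℕ.m∸[m∸n]≡n (ℕ.<⇒≤ m<N))))
  where
  m<N : m ℕ.< N
  m<N = ℕ.≰⇒> λ N≤m → w≢+ m N≤m ≡.refl
  1+[N∸1+m]≡N∸m : suc (N ∸ suc m) ≡ N ∸ m
  1+[N∸1+m]≡N∸m = ≡.sym (ℕ.+-∸-assoc 1 m<N)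
⊖-covers N -[1+ m ] w≢+ w≢- =
    N ℕ.+ m
  , s≤s (ℕ.≤-trans (ℕ.≤-reflexive (≡.sym (ℕ.+-suc N m))) (ℕ.+-monoʳ-≤ N m<N))
  , ≡.trans (≡.cong (N ⊖_) (≡.sym (ℕ.+-suc N m)))
      (≡.trans (ℤ.⊖-≤ (ℕ.m≤m+n N (suc m))) (≡.cong (λ i → ℤ.- (ℤ.+ i)) (ℕ.m+n∸m≡n N (suc m))))
  where
  m<N : m ℕ.< N
  m<N = ℕ.≰⇒> λ N≤m → w≢- m N≤m ≡.refl

-- The relaxation as a particle system.

module Stabilization (lem : ExcludedMiddle 0ℓ) (ℝ : CompleteOrderedField)
                     (α β : CompleteOrderedField.Carrier ℝ)
                     (α≤β : CompleteOrderedField._≤_ ℝ α β) where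

  open CompleteOrderedField ℝ
  open FieldProperties ℝ
  open Tropical lem ℝ α β
  open Series lem ℝ α β
  open Barriers lem ℝ α β
  open Relaxation lem ℝ α β α≤β

  -- Both branches of `G` that change nothing return `F` itself, so constancy is obtained as an
  -- equality of functions.
  G-cases : ∀ p F → G p F ≡ F ⊎ ∃ λ w → IsMonomialNear F p w ×
            G p F ≡ λ z → inf λ v → monomial (raise (coefficient F) w (proj₁ p)) v (proj₁ z)
  G-cases p F with lem {Differentiable F p}
  ... | no  _ = inj₁ ≡.refl
  ... | yes _ with lem {∃ (IsMonomialNear F p)}
  ...   | no  _          = inj₁ ≡.refl
  ...   | yes (w , near) = inj₂ (w , near , ≡.refl)

  module _ {n : ℕ} (p : Fin n → Ω°) (k : ℕ → Fin n) where

    points : Fin n → Carrier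
    points = proj₁ ∘ p

    B : Barrier points
    B = barrier α≤β points λ i → proj₁ (proj₁ (proj₂ (p i))) , proj₁ (proj₂ (proj₂ (p i)))

    open Confined B
    open Barrier B

    G-step : ∀ {F} i → Tame F → G (p i) F ≡ F ⊎
             (Raise (points i) (coefficient F) (coefficient (G (p i) F)) × Tame (G (p i) F))
    G-step {F} i tame with G-cases (p i) F
    ... | inj₁ same = inj₁ same
    -- The lemmas on raises speak of an exponent `ℤ.suc v`; `w` is rewritten as the successor of its
    -- predecessor.
    ... | inj₂ (w , near , G≡) = inj₂ (≡.subst₂ (λ w G → IsMonomialNear F (p i) w →
        G ≡ (λ z → inf λ v → monomial (raise (coefficient F) w (points i)) v (proj₁ z)) →
        Raise (points i) (coefficient F) (coefficient G) × Tame G)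
        (ℤ.suc-pred w) ≡.refl (raise-step (ℤ.pred w)) near G≡)
      where
      open Tame tame
      a = coefficient F
      raise-step : ∀ v {F′} → IsMonomialNear F (p i) (ℤ.suc v) →
        F′ ≡ (λ z → inf λ u → monomial (raise a (ℤ.suc v) (points i)) u (proj₁ z)) →
        Raise (points i) a (coefficient F′) × Tame F′
      raise-step v near ≡.refl = raise-resp , represented⇒tame conf rep
        where
        between = near⇒between (p i) v represents near
        right = proj₁ between
        left  = proj₂ between
        b = raise a (ℤ.suc v) (points i)
        conf : Confinement b
        conf = raise-confined confinement i v right left
        F′ : Ω → Carrier
        F′ z = inf λ u → monomial b u (proj₁ z)
        rep : Represents b F′
        rep z = inf-isInfimum (proj₂ (infimum conf z))
        c≈b : ∀ u → coefficient F′ u ≈ b u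
        c≈b = coefficient-≈ conf rep
        corner-≈ : ∀ u → corner (coefficient F′) u ≈ corner b u
        corner-≈ u = +-cong (c≈b u) (-‿cong (c≈b (ℤ.suc u)))
        raise-resp : Raise (points i) a (coefficient F′)
        raise-resp = record
          { v      = v
          ; raised = <-≤-trans raised (≤-reflexive (sym (c≈b (ℤ.suc v))))
          ; others = λ u u≢ → trans (c≈b u) (others u u≢)
          ; lands  = [ (λ (x<p , at) → inj₁ (x<p , trans (corner-≈ (ℤ.suc v)) at))
                     , (λ (p<x , at) → inj₂ (p<x , trans (corner-≈ v) at)) ]′ lands
          }
          where open Raise (raise-raises confinement i v right left) hiding (v)

    F : ℕ → Ω → Carrier
    F = relaxation p k

    tame : ∀ m → Tame (F m)
    tame zero    = zero-tame
    tame (suc m) with G-step (k m) (tame m)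
    ... | inj₁ same        = ≡.subst Tame (≡.sym same) (tame m)
    ... | inj₂ (_ , tame′) = tame′

    -- The exponents are listed in decreasing order, so that the corners increase.
    A : ℕ → ℕ → Carrier
    A m l = coefficient (F m) (N ⊖ l)

    open Particles lem ℝ points (suc (N ℕ.+ N)) A

    position≈corner : ∀ m {j w} → N ⊖ suc j ≡ w → corner (coefficient (F m)) w ≈ position m j
    position≈corner m {j} ≡.refl = +-congˡ (-‿cong (reflexive
      (≡.cong (coefficient (F m)) (suc[m⊖1+n]≡m⊖n N j))))

    -- Where `h` is at most `wall`, a coefficient is squeezed between them before and after the step
    -- and cannot grow strictly. So the raised exponent is among the finitely many that `⊖-covers`
    -- lists.
    raise⇒move : ∀ m → Raise (points (k m)) (coefficient (F m)) (coefficient (F (suc m))) → Move m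
    raise⇒move m record { v = v ; raised = raised ; others = others ; lands = lands }
      with ⊖-covers N (ℤ.suc v) not-high not-low
      where
      module Before = Confinement (Tame.confinement (tame m))
      module After = Confinement (Tame.confinement (tame (suc m)))
      h≰wall : ∀ u → u ≡ ℤ.suc v → ¬ (h u ≤ wall u)
      h≰wall _ ≡.refl h≤wall =
        <⇒≱ raised (≤-trans (After.a≤h _) (≤-trans h≤wall (Before.wall≤a (ℤ.suc v))))
      not-high : ∀ l → N ℕ.≤ l → ℤ.suc v ≢ ℤ.+ l
      not-high l N≤l eq = h≰wall _ (≡.sym eq) (h≤wall⁺ l N≤l)
      not-low : ∀ l → N ℕ.≤ l → ℤ.suc v ≢ -[1+ l ]
      not-low l N≤l eq = h≰wall _ (≡.sym eq) (h≤wall⁻ l N≤l)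
    ... | j , 2+j≤K , N⊖1+j≡1+v = record
      { 2+j≤K  = 2+j≤K
      ; i      = k m
      ; raised = ≡.subst (λ w → coefficient (F m) w ≤ coefficient (F (suc m)) w)
                   (≡.sym N⊖1+j≡1+v) (<⇒≤ raised)
      ; others = λ l l≢ → others (N ⊖ l) (λ eq → l≢ (⊖-injectiveʳ N (≡.trans eq (≡.sym N⊖1+j≡1+v))))
      ; lands  = [ (λ (x<p , at) → inj₁
                     ( ≤-<-trans (≤-reflexive (sym (position≈corner m N⊖1+j≡1+v))) x<p
                     , trans (sym (position≈corner (suc m) N⊖1+j≡1+v)) at))
                 , (λ (p<x , at) → inj₂
                     ( <-≤-trans p<x (≤-reflexive (position≈corner m N⊖2+j≡v))
                     , trans (sym (position≈corner (suc m) N⊖2+j≡v)) at)) ]′ lands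
      }
      where
      -- The listing reverses the order: corner `ℤ.suc v` is particle `j`, and corner `v` is
      -- particle `suc j`.
      N⊖2+j≡v : N ⊖ suc (suc j) ≡ v
      N⊖2+j≡v = suc-injective (≡.trans (suc[m⊖1+n]≡m⊖n N (suc j)) N⊖1+j≡1+v)

    stays-or-moves : ∀ m → F (suc m) ≡ F m ⊎ Move m
    stays-or-moves m with G-step (k m) (tame m)
    ... | inj₁ same        = inj₁ same
    ... | inj₂ (raise , _) = inj₂ (raise⇒move m raise)

    open Termination
      (λ j → h (N ⊖ j) , λ m → Confinement.a≤h (Tame.confinement (tame m)) (N ⊖ j))
      (λ m → [ (λ same → inj₁ λ j → reflexive (≡.cong (λ F → coefficient F (N ⊖ j)) same))
             , inj₂ ]′ (stays-or-moves m))

    stabilizes : ∃ λ m₀ → ∀ m → m₀ ℕ.≤ m → F m ≡ F m₀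
    stabilizes = M , λ m M≤m → constant (ℕ.≤⇒≤′ M≤m)
      where
      M = proj₁ moves-terminate
      constant : ∀ {m} → M ℕ.≤′ m → F m ≡ F M
      constant ℕ.≤′-refl = ≡.refl
      constant (ℕ.≤′-step {n = m} M≤m) =
        [ (λ same → ≡.trans same (constant M≤m))
        , (λ move → ⊥-elim (proj₂ moves-terminate m (ℕ.≤′⇒≤ M≤m) move))
        ]′ (stays-or-moves m)

open import Data.Nat using (_≤_)

mainTheorem1 : (lem : ExcludedMiddle 0ℓ) (ℝ : CompleteOrderedField) →
    let open CompleteOrderedField ℝ hiding (_≤_) in
    (α β : Carrier) → α < β →
    let open Tropical lem ℝ α β in
    (n : ℕ) (p : Fin n → Ω°) (k : ℕ → Fin n) →
    (∀ i N → ∃ λ j → N ≤ j × k j ≡ i) →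
    ∃ λ m₀ → 1 ≤ m₀ × (∀ m → m₀ ≤ m → ∀ z → relaxation p k m z ≈ relaxation p k m₀ z)
mainTheorem1 lem ℝ α β (α≤β , _) n p k _ =
  -- `M` may be 0, while the sequence of the theorem starts at index 1; hence the successor.
  suc M , s≤s z≤n , λ m M<m z → reflexive (≡.cong (λ F → F z)
    (≡.trans (constant m (ℕ.<⇒≤ M<m)) (≡.sym (constant (suc M) (ℕ.n≤1+n M)))))
  where
  open FieldProperties ℝ using (reflexive)
  stable = Stabilization.stabilizes lem ℝ α β α≤β p k
  M = proj₁ stable
  constant = proj₂ stable
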